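{- Let $k\ge 3$ be a fixed integer. For all sufficiently large $n$ (depending on $k$), \[ f(n,k,3,1)= \binom{n-k-1}{k-1}+1, \] and a $3$-cluster-free family $\mathcal{F}\subset\binom{[n]}{k}$ with matching number at least $2$ attains this size only if $\mathcal{F}$ is the disjoint union of a $k$-set and a star, i.e. only if there are a $k$-set $B\subset[n]$ and a vertex $x\in[n]\setminus B$ such that $\mathcal{F}=\{B\}\cup\left\{F\in\binom{[n]\setminus B}{k}:x\in F\right\}$.
   Context: $[n]=\{1,\dots,n\}$, and $\binom{V}{k}$ is the collection of all $k$-element subsets of a set $V$. A $d$-cluster of $k$-sets is a collection of $d$ different $k$-sets $A_1,\dots,A_d$ with $|A_1\cup\dots\cup A_d|\le 2k$ and $A_1\cap\dots\cap A_d=\emptyset$. A family $\mathcal{F}\subset\binom{[n]}{k}$ is $d$-cluster-free if it contains no $d$-cluster. The matching number $\nu(\mathcal{F})$ is the maximum number of pairwise disjoint sets in $\mathcal{F}$. $f(n,k,d,\nu)$ is the maximum size of a $d$-cluster-free family $\mathcal{F}\subset\binom{[n]}{k}$ with $\nu(\mathcal{F})\ge\nu+1$; in particular $f(n,k,d,1)$ is the maximum size of a $d$-cluster-free family that is not intersecting. A star is a family of $k$-sets containing a fixed vertex. -}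

module Defs where

open import Data.Nat using (ℕ; _≤_; _*_; suc)
open import Data.Fin.Subset using (Subset; ∣_∣; _∩_; ⋃; ⋂; Empty)
open import Data.List using (List; length)
open import Data.List.Membership.Propositional using () renaming (_∈_ to _∈ˡ_)
open import Data.List.Relation.Unary.All using (All)
open import Data.List.Relation.Unary.AllPairs using (AllPairs)
open import Data.List.Relation.Unary.Unique.Propositional using (Unique)
open import Data.Product using (_×_; ∃-syntax)
open import Relation.Binary.PropositionalEquality using (_≡_)
open import Relation.Nullary using (¬_)

-- The vertex set [n] is Fin n.  A family of k-subsets of [n] is listed without
-- repetition, so its cardinality is the length of the list; the order of the
-- list carries no meaning, and families are to be compared by membership only.
record Family (n k : ℕ) : Set where
  field
    members : List (Subset n)
    unique  : Unique members
    uniform : All (λ A → ∣ A ∣ ≡ k) members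

open Family public

size : ∀ {n k} → Family n k → ℕ
size 𝓕 = length (members 𝓕)

infix 4 _∈ᶠ_

_∈ᶠ_ : ∀ {n k} → Subset n → Family n k → Set
A ∈ᶠ 𝓕 = A ∈ˡ members 𝓕

record IsCluster {n : ℕ} (d k : ℕ) (As : List (Subset n)) : Set where
  field
    count        : length As ≡ d
    different    : Unique As
    uniform      : All (λ A → ∣ A ∣ ≡ k) As
    small-union  : ∣ ⋃ As ∣ ≤ 2 * k
    empty-common : Empty (⋂ As)

ClusterFree : ∀ {n k} → ℕ → Family n k → Set
ClusterFree {n} {k} d 𝓕 =
  ¬ (∃[ As ] (IsCluster {n} d k As × All (_∈ᶠ 𝓕) As))

Disjoint : ∀ {n} → Subset n → Subset n → Set
Disjoint A B = Empty (A ∩ B)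

record IsMatching {n k : ℕ} (𝓕 : Family n k) (M : List (Subset n)) : Set where
  field
    different : Unique M
    inFamily  : All (_∈ᶠ 𝓕) M
    disjoint  : AllPairs Disjoint M

IsMaximum : (ℕ → Set) → ℕ → Set
IsMaximum P m = P m × (∀ m′ → P m′ → m′ ≤ m)

-- IsMatchingNumber 𝓕 m says ν(𝓕) = m.
IsMatchingNumber : ∀ {n k} → Family n k → ℕ → Set
IsMatchingNumber 𝓕 =
  IsMaximum (λ m → ∃[ M ] (IsMatching 𝓕 M × length M ≡ m))

-- MatchingNumber≥ 𝓕 t says ν(𝓕) ≥ t.
MatchingNumber≥ : ∀ {n k} → Family n k → ℕ → Set
MatchingNumber≥ 𝓕 t = ∃[ m ] (IsMatchingNumber 𝓕 m × t ≤ m)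

-- f[ n , k , d , ν ]≡ m says f(n,k,d,ν) = m.  It is a relation because the
-- maximum need not exist when no family qualifies.
f[_,_,_,_]≡_ : ℕ → ℕ → ℕ → ℕ → ℕ → Set
f[ n , k , d , ν ]≡ m =
  IsMaximum
    (λ s → ∃[ 𝓕 ] (ClusterFree {n} {k} d 𝓕 × MatchingNumber≥ 𝓕 (suc ν) × size 𝓕 ≡ s))
    m

{-# OPTIONS --safe #-}
{-
Three distinct members F, G, H of 𝓕 with F ⊆ G ∪ H and F ∩ G ∩ H = ∅ form a 3-cluster, since then
F ∪ G ∪ H = G ∪ H; every cluster below has this shape.

Call S flexible if for every W disjoint from S with at most k elements some member of 𝓕 contains S
and avoids W; otherwise fix a blocking set W for S.  All but O(n^(k-2)) members F are good: no
S ⊆ F has a blocking set meeting F twice, nor y ∈ F in its blocking set with S + y again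
inflexible and S + y ≠ F.  Within a good F the flexible sets are closed under intersection, every
F - a - b is flexible unless F - a or F - b is, and a set and its complement in F are never both
flexible.  Hence F has a center x (every S ⊆ F containing x is flexible), or at least two of its
vertices are flexible as singletons.  If {r} is flexible, then F - r lies in no other member, so
counting (k-1)-sets shows that when |𝓕| exceeds the claimed bound, all but O(n^(k-2)) of the
(k-1)-sets are of the form F - x with x a center of F.  Label them by x.  Two labelled sets that
intersect have the same label, which forces a single label x on all but O(n^(k-2)) of them.

So almost every k-set through x is in 𝓕.  If B ∈ 𝓕 and x ∉ B, each member F ∋ x meeting B excludes
from 𝓕 every k-set G ⊇ F \ B disjoint from B; there are at least n - 2k such G, and each G is
excluded by boundedly many F.  Thus x-sets meeting B cost more than they gain.  A vertex in the union
of the members missing x is therefore in Ω(n^(k-2)) missing x-sets, so this union has bounded size,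
and a second member missing x would cost more than the bounded number of such members gains.
-}
module Submission where

open import Defs
open import Data.Nat hiding (∣_-_∣)
open import Data.Nat.Properties
open import Data.Nat.Combinatorics using (_C_; nCk+nC[k+1]≡[n+1]C[k+1])
open import Data.Nat.Tactic.RingSolver using (solve-∀)
import Data.Bool.Properties as Bool
open import Data.Fin using (Fin; zero; suc)
import Data.Fin.Properties as Fin
open import Data.Fin.Subset
open import Data.Fin.Subset.Properties
open import Data.Vec using ([]; _∷_; here; there)
import Data.Vec.Properties as Vec
open import Data.List using (List; []; _∷_; map; _++_; length; filter; concatMap; allFin; tabulate)
import Data.List.Properties as List
open import Data.List.Membership.Propositional using (find) renaming (_∈_ to _∈ˡ_)
open import Data.List.Membership.Propositional.Properties 
  using (∈-map⁺; ∈-map⁻; ∈-++⁺ˡ; ∈-++⁺ʳ; ∈-allFin; ∈-filter⁺; ∈-filter⁻; ∈-concatMap⁺)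
import Data.List.Membership.DecPropositional as DecMembership
open import Data.List.Relation.Unary.Any as Any using (here; there)
open import Data.List.Relation.Unary.All as All using (All; []; _∷_)
open import Data.List.Relation.Unary.All.Properties using (¬All⇒Any¬)
open import Data.List.Relation.Unary.AllPairs using ([]; _∷_)
open import Data.List.Relation.Unary.Unique.Propositional using (Unique)
import Data.List.Relation.Unary.Unique.Propositional.Properties as Unique
open import Data.Product using (_×_; _,_; proj₁; proj₂; ∃; ∃-syntax)
open import Data.Sum as Sum using (_⊎_; inj₁; inj₂)
open import Data.Empty using (⊥-elim) renaming (⊥ to Absurd)
open import Function using (_∘_; id)
open import Function.Bundles using (_⇔_; mk⇔; Equivalence)
open import Relation.Unary using (Decidable)
open import Relation.Nullary
open import Relation.Nullary.Decidable using (_×-dec_; _→-dec_; ¬?; decidable-stable; toSum)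
open import Relation.Binary.Definitions using (DecidableEquality)
open import Relation.Binary.PropositionalEquality

-- Finite sums and counting

ind : {P : Set} → Dec P → ℕ
ind (yes _) = 1
ind (no _)  = 0

ind-yes : {P : Set} (d : Dec P) → P → ind d ≡ 1
ind-yes (yes _) _ = refl
ind-yes (no ¬p) p = contradiction p ¬p

ind-no : {P : Set} (d : Dec P) → ¬ P → ind d ≡ 0
ind-no (yes p) ¬p = contradiction p ¬p
ind-no (no _)  _  = refl

ind≤1 : {P : Set} (d : Dec P) → ind d ≤ 1
ind≤1 (yes _) = ≤-refl
ind≤1 (no _)  = z≤n

ind-mono : {P Q : Set} (d : Dec P) (e : Dec Q) → (P → Q) → ind d ≤ ind e
ind-mono (no _)  e f = z≤n
ind-mono (yes p) e f = ≤-reflexive (sym (ind-yes e (f p)))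

module _ {A : Set} where

  Σ[_] : List A → (A → ℕ) → ℕ
  Σ[ [] ]     f = 0
  Σ[ x ∷ xs ] f = f x + Σ[ xs ] f

  Σ-mono : ∀ xs {f g : A → ℕ} → (∀ x → f x ≤ g x) → Σ[ xs ] f ≤ Σ[ xs ] g
  Σ-mono []       f≤g = z≤n
  Σ-mono (x ∷ xs) f≤g = +-mono-≤ (f≤g x) (Σ-mono xs f≤g)

  Σ-cong : ∀ xs {f g : A → ℕ} → (∀ x → f x ≡ g x) → Σ[ xs ] f ≡ Σ[ xs ] g
  Σ-cong []       f≡g = refl
  Σ-cong (x ∷ xs) f≡g = cong₂ _+_ (f≡g x) (Σ-cong xs f≡g)

  Σ-zero : ∀ xs → Σ[ xs ] (λ _ → 0) ≡ 0
  Σ-zero []       = refl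
  Σ-zero (x ∷ xs) = Σ-zero xs

  Σ-const : ∀ xs c → Σ[ xs ] (λ _ → c) ≡ length xs * c
  Σ-const []       c = refl
  Σ-const (x ∷ xs) c = cong (c +_) (Σ-const xs c)

  Σ-+ : ∀ xs (f g : A → ℕ) → Σ[ xs ] (λ x → f x + g x) ≡ Σ[ xs ] f + Σ[ xs ] g
  Σ-+ []       f g = refl
  Σ-+ (x ∷ xs) f g = begin
    f x + g x + Σ[ xs ] (λ y → f y + g y)     ≡⟨ cong (f x + g x +_) (Σ-+ xs f g) ⟩
    f x + g x + (Σ[ xs ] f + Σ[ xs ] g)       ≡⟨ +-assoc (f x) (g x) _ ⟩
    f x + (g x + (Σ[ xs ] f + Σ[ xs ] g))     ≡⟨ cong (f x +_) (sym (+-assoc (g x) _ _)) ⟩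
    f x + (g x + Σ[ xs ] f + Σ[ xs ] g)       ≡⟨ cong (λ t → f x + (t + Σ[ xs ] g)) (+-comm (g x) _) ⟩
    f x + (Σ[ xs ] f + g x + Σ[ xs ] g)       ≡⟨ cong (f x +_) (+-assoc (Σ[ xs ] f) _ _) ⟩
    f x + (Σ[ xs ] f + (g x + Σ[ xs ] g))     ≡⟨ sym (+-assoc (f x) _ _) ⟩
    f x + Σ[ xs ] f + (g x + Σ[ xs ] g)       ∎
    where open ≡-Reasoning

  Σ-* : ∀ xs c (f : A → ℕ) → Σ[ xs ] (λ x → c * f x) ≡ c * Σ[ xs ] f
  Σ-* []       c f = sym (*-zeroʳ c)
  Σ-* (x ∷ xs) c f = trans (cong (c * f x +_) (Σ-* xs c f)) (sym (*-distribˡ-+ c (f x) _))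

  Σ-++ : ∀ xs ys (f : A → ℕ) → Σ[ xs ++ ys ] f ≡ Σ[ xs ] f + Σ[ ys ] f
  Σ-++ []       ys f = refl
  Σ-++ (x ∷ xs) ys f = trans (cong (f x +_) (Σ-++ xs ys f)) (sym (+-assoc (f x) _ _))

  count : {P : A → Set} → List A → Decidable P → ℕ
  count xs P? = Σ[ xs ] (λ x → ind (P? x))

  length-filter≡count : ∀ {P : A → Set} (P? : Decidable P) xs → length (filter P? xs) ≡ count xs P?
  length-filter≡count P? [] = refl
  length-filter≡count P? (x ∷ xs) with P? x
  ... | yes _ = cong suc (length-filter≡count P? xs)
  ... | no _  = length-filter≡count P? xs

  module _ {P Q : A → Set} (P? : Decidable P) (Q? : Decidable Q) where

    count-mono : ∀ xs → (∀ x → P x → Q x) → count xs P? ≤ count xs Q?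
    count-mono xs P⇒Q = Σ-mono xs (λ x → ind-mono (P? x) (Q? x) (P⇒Q x))

    count-split : ∀ {R : A → Set} (R? : Decidable R) xs → (∀ x → P x → Q x ⊎ R x) →
      count xs P? ≤ count xs Q? + count xs R?
    count-split R? xs f = ≤-trans (Σ-mono xs pointwise) (≤-reflexive (Σ-+ xs _ _))
      where
      pointwise : ∀ x → ind (P? x) ≤ ind (Q? x) + ind (R? x)
      pointwise x with P? x
      ... | no _  = z≤n
      ... | yes p with f x p
      ...   | inj₁ q = ≤-trans (≤-reflexive (sym (ind-yes (Q? x) q))) (m≤m+n _ _)
      ...   | inj₂ r = ≤-trans (≤-reflexive (sym (ind-yes (R? x) r))) (m≤n+m _ _)

    count-disjoint : ∀ {R : A → Set} (R? : Decidable R) xs →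
      (∀ x → P x → R x) → (∀ x → Q x → R x) → (∀ x → P x → ¬ Q x) →
      count xs P? + count xs Q? ≤ count xs R?
    count-disjoint R? xs P⇒R Q⇒R disj =
      ≤-trans (≤-reflexive (sym (Σ-+ xs _ _))) (Σ-mono xs pointwise)
      where
      pointwise : ∀ x → ind (P? x) + ind (Q? x) ≤ ind (R? x)
      pointwise x with P? x | Q? x
      ... | no _  | no _  = z≤n
      ... | no _  | yes q = ≤-reflexive (sym (ind-yes (R? x) (Q⇒R x q)))
      ... | yes p | no _  = ≤-reflexive (sym (ind-yes (R? x) (P⇒R x p)))
      ... | yes p | yes q = contradiction q (disj x p)

  count-cong : ∀ {P Q : A → Set} (P? : Decidable P) (Q? : Decidable Q) xs →
    (∀ x → P x → Q x) → (∀ x → Q x → P x) → count xs P? ≡ count xs Q?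
  count-cong P? Q? xs f g = ≤-antisym (count-mono P? Q? xs f) (count-mono Q? P? xs g)

  count-none : ∀ {P : A → Set} (P? : Decidable P) xs → (∀ x → ¬ P x) → count xs P? ≡ 0
  count-none P? xs none = trans (Σ-cong xs (λ x → ind-no (P? x) (none x))) (Σ-zero xs)

  count-one : ∀ {P : A → Set} (P? : Decidable P) {xs x} → x ∈ˡ xs → P x → 1 ≤ count xs P?
  count-one P? {x ∷ xs} (here refl) p = ≤-trans (≤-reflexive (sym (ind-yes (P? x) p))) (m≤m+n _ _)
  count-one P? {y ∷ xs} (there x∈)  p = ≤-trans (count-one P? x∈ p) (m≤n+m _ _)

  count-unique : ∀ {P : A → Set} (P? : Decidable P) {xs} → Unique xs →
    (∀ {x y} → P x → P y → x ≡ y) → count xs P? ≤ 1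
  count-unique P? []         uniq = z≤n
  count-unique P? {x ∷ xs} (x∉ ∷ u) uniq with P? x
  ... | no _  = count-unique P? u uniq
  ... | yes p = ≤-reflexive (cong suc (rest x∉))
    where
    rest : ∀ {ys} → All (x ≢_) ys → count ys P? ≡ 0
    rest []           = refl
    rest {y ∷ ys} (x≢y ∷ a) = cong₂ _+_ (ind-no (P? y) (λ q → x≢y (uniq p q))) (rest a)

  count-witness : ∀ {P : A → Set} (P? : Decidable P) xs → 1 ≤ count xs P? → ∃ P
  count-witness P? (x ∷ xs) pos with P? x
  ... | yes p = x , p
  ... | no _  = count-witness P? xs pos

module _ {A B : Set} where

  Σ-swap : ∀ (xs : List A) (ys : List B) (f : A → B → ℕ) →
    Σ[ xs ] (λ x → Σ[ ys ] (f x)) ≡ Σ[ ys ] (λ y → Σ[ xs ] (λ x → f x y))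
  Σ-swap []       ys f = sym (Σ-zero ys)
  Σ-swap (x ∷ xs) ys f =
    trans (cong (Σ[ ys ] (f x) +_) (Σ-swap xs ys f)) (sym (Σ-+ ys _ _))

  Σ-map : ∀ (h : A → B) xs (f : B → ℕ) → Σ[ map h xs ] f ≡ Σ[ xs ] (f ∘ h)
  Σ-map h []       f = refl
  Σ-map h (x ∷ xs) f = cong (f (h x) +_) (Σ-map h xs f)

  -- Double counting of the pairs in `R`, by rows and then by columns. The weight `f` is arbitrary
  -- so that some elements can be charged twice, as in `good+other≤facets`.
  Σ-bounded-degree : ∀ (xs : List A) (ys : List B) {R : A → B → Set} {Q : B → Set}
    (R? : ∀ x y → Dec (R x y)) (Q? : Decidable Q) {f : A → ℕ} {b : ℕ} →
    (∀ x → f x ≤ count ys (R? x)) →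
    (∀ y → Q y → count xs (λ x → R? x y) ≤ b) →
    (∀ x y → R x y → Q y) →
    Σ[ xs ] f ≤ b * count ys Q?
  Σ-bounded-degree xs ys {R} {Q} R? Q? {f} {b} lower upper R⇒Q = begin
    Σ[ xs ] f                                          ≤⟨ Σ-mono xs lower ⟩
    Σ[ xs ] (λ x → Σ[ ys ] (λ y → ind (R? x y)))       ≡⟨ Σ-swap xs ys _ ⟩
    Σ[ ys ] (λ y → count xs (λ x → R? x y))            ≤⟨ Σ-mono ys pointwise ⟩
    Σ[ ys ] (λ y → b * ind (Q? y))                     ≡⟨ Σ-* ys b _ ⟩
    b * count ys Q?                                    ∎
    where
    open ≤-Reasoning
    pointwise : ∀ y → count xs (λ x → R? x y) ≤ b * ind (Q? y)
    pointwise y with Q? y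
    ... | yes q = ≤-trans (upper y q) (≤-reflexive (sym (*-identityʳ b)))
    ... | no ¬q = ≤-trans (≤-reflexive (count-none (λ x → R? x y) xs (λ x r → ¬q (R⇒Q x y r)))) z≤n

  -- The factor `c` replaces a division: every `x` in `P` has at least `a / c` partners.
  double-count : ∀ (xs : List A) (ys : List B) {P : A → Set} {R : A → B → Set} {Q : B → Set}
    (P? : Decidable P) (R? : ∀ x y → Dec (R x y)) (Q? : Decidable Q) {a b c : ℕ} →
    (∀ x → P x → a ≤ c * count ys (R? x)) →
    (∀ y → Q y → count xs (λ x → R? x y) ≤ b) →
    (∀ x y → R x y → Q y) →
    a * count xs P? ≤ c * (b * count ys Q?)
  double-count xs ys {P} P? R? Q? {a} {b} {c} lower upper R⇒Q = begin
    a * count xs P?                                ≡⟨ sym (Σ-* xs a _) ⟩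
    Σ[ xs ] (λ x → a * ind (P? x))                 ≤⟨ Σ-mono xs pointwise ⟩
    Σ[ xs ] (λ x → c * count ys (R? x))            ≡⟨ Σ-* xs c _ ⟩
    c * Σ[ xs ] (λ x → count ys (R? x))            ≤⟨ *-monoʳ-≤ c (Σ-bounded-degree xs ys R? Q? (λ _ → ≤-refl) upper R⇒Q) ⟩
    c * (b * count ys Q?)                          ∎
    where
    open ≤-Reasoning
    pointwise : ∀ x → a * ind (P? x) ≤ c * count ys (R? x)
    pointwise x with P? x
    ... | yes p = ≤-trans (≤-reflexive (*-identityʳ a)) (lower x p)
    ... | no _  = ≤-trans (≤-reflexive (*-zeroʳ a)) z≤n

  count-relation : ∀ (xs : List A) (ys : List B) {P : A → Set} {R : A → B → Set} {Q : B → Set}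
    (P? : Decidable P) (R? : ∀ x y → Dec (R x y)) (Q? : Decidable Q) {b : ℕ} →
    (∀ x → P x → 1 ≤ count ys (R? x)) →
    (∀ y → Q y → count xs (λ x → R? x y) ≤ b) →
    (∀ x y → R x y → Q y) →
    count xs P? ≤ b * count ys Q?
  count-relation xs ys P? R? Q? {b} lower upper R⇒Q = begin
    count xs P?                ≡⟨ sym (*-identityˡ _) ⟩
    1 * count xs P?            ≤⟨ double-count xs ys P? R? Q? {1} {b} {1}
                                    (λ x p → ≤-trans (lower x p) (≤-reflexive (sym (*-identityˡ _)))) upper R⇒Q ⟩
    1 * (b * count ys Q?)      ≡⟨ *-identityˡ _ ⟩
    b * count ys Q?            ∎
    where open ≤-Reasoning

-- `0 ≤ 0` serves as the trivially true predicate, which turns the length of a list into a count.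
always : ∀ {A : Set} → Decidable {A = A} (λ _ → 0 ≤ 0)
always _ = yes z≤n

count-always : ∀ {A : Set} (xs : List A) → count xs always ≡ length xs
count-always xs = trans (Σ-const xs 1) (*-identityʳ _)

module _ {A : Set} (_≟ᴬ_ : DecidableEquality A) where

  -- Counted through equality: uniqueness of `xs` lets each entry of `ys` be matched at most once,
  -- so repetitions in `ys`, such as those in a list of codes, do no harm.
  count≤length : ∀ {P : A → Set} (P? : Decidable P) {xs} ys → Unique xs → (∀ x → P x → x ∈ˡ ys) →
    count xs P? ≤ length ys
  count≤length P? {xs} ys u P⊆ys = ≤-trans
    (count-relation xs ys P? _≟ᴬ_ always {1}
      (λ x p → count-one (x ≟ᴬ_) (P⊆ys x p) refl)
      (λ y _ → count-unique (_≟ᴬ y) u (λ p q → trans p (sym q)))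
      (λ _ _ _ → z≤n))
    (≤-reflexive (trans (*-identityˡ _) (count-always ys)))

  length≤count : ∀ {P : A → Set} (P? : Decidable P) {xs ys} → Unique ys →
    (∀ x → x ∈ˡ xs) → All P ys → length ys ≤ count xs P?
  length≤count {P} P? {xs} {ys} u complete ys⊆P = begin
    length ys                                  ≡⟨ count-all ys⊆P ⟨
    count ys P?                                ≤⟨ count-relation ys xs P? (λ y x → P? x ×-dec (x ≟ᴬ y)) P? {1}
                                                    (λ y p → count-one (λ x → P? x ×-dec (x ≟ᴬ y)) (complete y) (p , refl))
                                                    (λ x _ → count-unique (λ y → P? x ×-dec (x ≟ᴬ y)) u
                                                      (λ p q → trans (sym (proj₂ p)) (proj₂ q)))
                                                    (λ _ _ → proj₁) ⟩
    1 * count xs P?                            ≡⟨ *-identityˡ _ ⟩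
    count xs P?                                ∎
    where
    open ≤-Reasoning
    count-all : ∀ {ys} → All P ys → count ys P? ≡ length ys
    count-all []       = refl
    count-all {y ∷ _} (p ∷ ps) = cong₂ _+_ (ind-yes (P? y) p) (count-all ps)

-- Counting vertices and subsets

subsets : ∀ n → List (Subset n)
subsets zero    = [] ∷ []
subsets (suc n) = map (outside ∷_) (subsets n) ++ map (inside ∷_) (subsets n)

∈-subsets : ∀ {n} (p : Subset n) → p ∈ˡ subsets n
∈-subsets []            = here refl
∈-subsets (outside ∷ p) = ∈-++⁺ˡ (∈-map⁺ _ (∈-subsets p))
∈-subsets {suc n} (inside ∷ p)  = ∈-++⁺ʳ (map (outside ∷_) (subsets n)) (∈-map⁺ _ (∈-subsets p))

subsets-unique : ∀ n → Unique (subsets n)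
subsets-unique zero    = [] ∷ []
subsets-unique (suc n) = Unique.++⁺
  (Unique.map⁺ Vec.∷-injectiveʳ (subsets-unique n))
  (Unique.map⁺ Vec.∷-injectiveʳ (subsets-unique n))
  disjoint
  where
  disjoint : ∀ {p} → ¬ (p ∈ˡ map (outside ∷_) (subsets n) × p ∈ˡ map (inside ∷_) (subsets n))
  disjoint (p∈₁ , p∈₂) with ∈-map⁻ _ p∈₁ | ∈-map⁻ _ p∈₂
  ... | _ , _ , refl | _ , _ , ()

infix 4 _≟ˢ_
_≟ˢ_ : ∀ {n} → DecidableEquality (Subset n)
_≟ˢ_ = Vec.≡-dec Bool._≟_

infix 4 _∈ˡ?_ _∈ᶠ?_

_∈ˡ?_ : ∀ {n} (p : Subset n) ps → Dec (p ∈ˡ ps)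
_∈ˡ?_ = DecMembership._∈?_ _≟ˢ_

_∈ᶠ?_ : ∀ {n k} p (𝓕 : Family n k) → Dec (p ∈ᶠ 𝓕)
p ∈ᶠ? 𝓕 = p ∈ˡ? Family.members 𝓕

# : ∀ {n} {P : Subset n → Set} → Decidable P → ℕ
# {n} P? = count (subsets n) P?

#-suc : ∀ {n} {P : Subset (suc n) → Set} (P? : Decidable P) →
  # P? ≡ # (λ p → P? (outside ∷ p)) + # (λ p → P? (inside ∷ p))
#-suc {n} P? = trans (Σ-++ (map (outside ∷_) (subsets n)) _ _)
  (cong₂ _+_ (Σ-map _ (subsets n) _) (Σ-map _ (subsets n) _))

#-one : ∀ {n} {P : Subset n → Set} (P? : Decidable P) p → P p → 1 ≤ # P?
#-one P? p = count-one P? (∈-subsets p)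

#-unique : ∀ {n} {P : Subset n → Set} (P? : Decidable P) → (∀ {p q} → P p → P q → p ≡ q) → # P? ≤ 1
#-unique P? = count-unique P? (subsets-unique _)

-- Binomial coefficients and the sets between two given sets

binom : ℕ → ℕ → ℕ
binom n       zero    = 1
binom zero    (suc k) = 0
binom (suc n) (suc k) = binom n k + binom n (suc k)

binom≡C : ∀ n k → binom n k ≡ n C k
binom≡C zero    zero    = refl
binom≡C (suc n) zero    = refl
binom≡C zero    (suc k) = refl
binom≡C (suc n) (suc k) = trans (cong₂ _+_ (binom≡C n k) (binom≡C n (suc k))) (nCk+nC[k+1]≡[n+1]C[k+1] n k)

Between : ∀ {n} → Subset n → Subset n → ℕ → Subset n → Set
Between p q j r = p ⊆ r × r ⊆ q × ∣ r ∣ ≡ j + ∣ p ∣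

between? : ∀ {n} p q j → Decidable (Between {n} p q j)
between? p q j r = (p ⊆? r) ×-dec (r ⊆? q) ×-dec (∣ r ∣ ≟ j + ∣ p ∣)

#-split : ∀ {n} {P : Subset (suc n) → Set} (P? : Decidable P) {a b} →
  # (λ p → P? (outside ∷ p)) ≡ a → # (λ p → P? (inside ∷ p)) ≡ b → # P? ≡ a + b
#-split P? eq₁ eq₂ = trans (#-suc P?) (cong₂ _+_ eq₁ eq₂)

#-cong : ∀ {n} {P Q : Subset n → Set} (P? : Decidable P) (Q? : Decidable Q) →
  (∀ p → P p → Q p) → (∀ p → Q p → P p) → # P? ≡ # Q?
#-cong P? Q? = count-cong P? Q? (subsets _)

#-none : ∀ {n} {P : Subset n → Set} (P? : Decidable P) → (∀ p → ¬ P p) → # P? ≡ 0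
#-none P? = count-none P? (subsets _)

0∉outside∷p : ∀ {n} {p : Subset n} → zero ∉ outside ∷ p
0∉outside∷p ()

-- Here `d` is the size of `q ─ p`. A first vertex in both sets is forced in, one in neither is
-- forced out, and one in `q` alone splits the count into the two summands of Pascal's rule, by
-- which `binom` is defined.
#between : ∀ {n} (p q : Subset n) d j → p ⊆ q → ∣ q ∣ ≡ d + ∣ p ∣ → # (between? p q j) ≡ binom d j
#between [] [] zero zero p⊆q eq = refl
#between [] [] zero (suc j) p⊆q eq = refl
#between (inside ∷ p) (outside ∷ q) d j p⊆q eq with () ← p⊆q here
#between (outside ∷ p) (outside ∷ q) d j p⊆q eq =
  trans (#-split (between? (outside ∷ p) (outside ∷ q) j)
    (#-cong (λ r → between? (outside ∷ p) (outside ∷ q) j (outside ∷ r)) (between? p q j)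
      (λ r (a , b , c) → drop-∷-⊆ a , drop-∷-⊆ b , c) (λ r (a , b , c) → s⊆s a , s⊆s b , c))
    (#-none (λ r → between? (outside ∷ p) (outside ∷ q) j (inside ∷ r)) (λ r (a , b , c) → 0∉outside∷p (b here))))
  (trans (+-identityʳ _) (#between p q d j (drop-∷-⊆ p⊆q) eq))
#between (inside ∷ p) (inside ∷ q) d j p⊆q eq =
  trans (#-split (between? (inside ∷ p) (inside ∷ q) j)
    (#-none (λ r → between? (inside ∷ p) (inside ∷ q) j (outside ∷ r)) (λ r (a , b , c) → 0∉outside∷p (a here)))
    (#-cong (λ r → between? (inside ∷ p) (inside ∷ q) j (inside ∷ r)) (between? p q j)
      (λ r (a , b , c) → drop-∷-⊆ a , drop-∷-⊆ b , suc-injective (trans c (+-suc j _)))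
      (λ r (a , b , c) → s⊆s a , s⊆s b , trans (cong suc c) (sym (+-suc j _)))))
  (#between p q d j (drop-∷-⊆ p⊆q) (suc-injective (trans eq (+-suc d _))))
#between (outside ∷ p) (inside ∷ q) zero j p⊆q eq =
  contradiction (p⊆q⇒∣p∣≤∣q∣ (drop-∷-⊆ p⊆q)) (<⇒≱ (≤-reflexive eq))
#between (outside ∷ p) (inside ∷ q) (suc d) zero p⊆q eq =
  trans (#-split (between? (outside ∷ p) (inside ∷ q) 0)
    (#-cong (λ r → between? (outside ∷ p) (inside ∷ q) 0 (outside ∷ r)) (between? p q 0)
      (λ r (a , b , c) → drop-∷-⊆ a , drop-∷-⊆ b , c) (λ r (a , b , c) → s⊆s a , out⊆ b , c))
    (#-none (λ r → between? (outside ∷ p) (inside ∷ q) 0 (inside ∷ r)) (λ r (a , b , c) →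
      contradiction (p⊆q⇒∣p∣≤∣q∣ (drop-∷-⊆ a)) (<⇒≱ (≤-reflexive c)))))
  (trans (+-identityʳ _) (#between p q d 0 (drop-∷-⊆ p⊆q) (suc-injective eq)))
#between (outside ∷ p) (inside ∷ q) (suc d) (suc j) p⊆q eq =
  trans (#-split (between? (outside ∷ p) (inside ∷ q) (suc j))
    (trans (#-cong (λ r → between? (outside ∷ p) (inside ∷ q) (suc j) (outside ∷ r)) (between? p q (suc j))
      (λ r (a , b , c) → drop-∷-⊆ a , drop-∷-⊆ b , c) (λ r (a , b , c) → s⊆s a , out⊆ b , c))
      (#between p q d (suc j) (drop-∷-⊆ p⊆q) (suc-injective eq)))
    (trans (#-cong (λ r → between? (outside ∷ p) (inside ∷ q) (suc j) (inside ∷ r)) (between? p q j)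
      (λ r (a , b , c) → drop-∷-⊆ a , drop-∷-⊆ b , suc-injective c) (λ r (a , b , c) → out⊆ a , s⊆s b , cong suc c))
      (#between p q d j (drop-∷-⊆ p⊆q) (suc-injective eq))))
  (+-comm (binom d (suc j)) _)

#subsets : ∀ {n} (q : Subset n) → # (_⊆? q) ≡ 2 ^ ∣ q ∣
#subsets [] = refl
#subsets (outside ∷ q) =
  trans (#-split (_⊆? (outside ∷ q))
    (#-cong (λ r → outside ∷ r ⊆? outside ∷ q) (_⊆? q) (λ r a → drop-∷-⊆ a) (λ r a → s⊆s a))
    (#-none (λ r → inside ∷ r ⊆? outside ∷ q) (λ r a → 0∉outside∷p (a here))))
  (trans (+-identityʳ _) (#subsets q))
#subsets (inside ∷ q) = #-split (_⊆? (inside ∷ q))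
  (trans (#-cong (λ r → outside ∷ r ⊆? inside ∷ q) (_⊆? q) (λ r a → drop-∷-⊆ a) (λ r a → out⊆ a)) (#subsets q))
  (trans (#-cong (λ r → inside ∷ r ⊆? inside ∷ q) (_⊆? q) (λ r a → drop-∷-⊆ a) (λ r a → s⊆s a))
    (trans (#subsets q) (sym (+-identityʳ _))))

∣∣≡count : ∀ {n} (p : Subset n) → count (allFin n) (_∈? p) ≡ ∣ p ∣
∣∣≡count {zero} [] = refl
∣∣≡count {suc n} (s ∷ p) = trans (cong (ind (zero ∈? (s ∷ p)) +_) shift) (step s)
  where
  shift : count (tabulate suc) (_∈? (s ∷ p)) ≡ ∣ p ∣
  shift = begin
    count (tabulate suc) (_∈? (s ∷ p))           ≡⟨ cong (λ l → count l (_∈? (s ∷ p))) (sym (List.map-tabulate id suc)) ⟩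
    count (map suc (allFin n)) (_∈? (s ∷ p))     ≡⟨ Σ-map suc (allFin n) _ ⟩
    count (allFin n) (λ v → suc v ∈? (s ∷ p))    ≡⟨ count-cong _ (_∈? p) (allFin n) (λ _ → drop-there) (λ _ → there) ⟩
    count (allFin n) (_∈? p)                     ≡⟨ ∣∣≡count p ⟩
    ∣ p ∣                                        ∎
    where open ≡-Reasoning
  step : ∀ s → ind (zero ∈? (s ∷ p)) + ∣ p ∣ ≡ ∣ s ∷ p ∣
  step outside = cong (_+ ∣ p ∣) (ind-no (zero ∈? (outside ∷ p)) λ ())
  step inside  = cong (_+ ∣ p ∣) (ind-yes (zero ∈? (inside ∷ p)) here)

elements : ∀ {n} → Subset n → List (Fin n)
elements p = filter (_∈? p) (allFin _)

∣elements∣ : ∀ {n} (p : Subset n) → length (elements p) ≡ ∣ p ∣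
∣elements∣ p = trans (length-filter≡count (_∈? p) (allFin _)) (∣∣≡count p)

-- Cardinalities of subsets

x∈p─q⁻ : ∀ {n} (p q : Subset n) {x} → x ∈ p ─ q → x ∈ p × x ∉ q
x∈p─q⁻ (inside ∷ p) (outside ∷ q) here = here , λ ()
x∈p─q⁻ (a ∷ p) (outside ∷ q) (there x∈) with x∈p─q⁻ p q x∈
... | i , o = there i , λ { (there x) → o x }
x∈p─q⁻ (a ∷ p) (inside ∷ q) (there x∈) with x∈p─q⁻ p q x∈
... | i , o = there i , λ { (there x) → o x }

∣p∪q∣≤∣p∣+∣q∣ : ∀ {n} (p q : Subset n) → ∣ p ∪ q ∣ ≤ ∣ p ∣ + ∣ q ∣
∣p∪q∣≤∣p∣+∣q∣ [] [] = z≤n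
∣p∪q∣≤∣p∣+∣q∣ (outside ∷ p) (outside ∷ q) = ∣p∪q∣≤∣p∣+∣q∣ p q
∣p∪q∣≤∣p∣+∣q∣ (outside ∷ p) (inside ∷ q)  = ≤-trans (s≤s (∣p∪q∣≤∣p∣+∣q∣ p q)) (≤-reflexive (sym (+-suc _ _)))
∣p∪q∣≤∣p∣+∣q∣ (inside ∷ p) (outside ∷ q)  = s≤s (∣p∪q∣≤∣p∣+∣q∣ p q)
∣p∪q∣≤∣p∣+∣q∣ (inside ∷ p) (inside ∷ q)   = s≤s (≤-trans (∣p∪q∣≤∣p∣+∣q∣ p q) (+-monoʳ-≤ ∣ p ∣ (n≤1+n _)))

∣p∪q∣≡∣p∣+∣q∣ : ∀ {n} (p q : Subset n) → (∀ {x} → x ∈ p → x ∉ q) → ∣ p ∪ q ∣ ≡ ∣ p ∣ + ∣ q ∣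
∣p∪q∣≡∣p∣+∣q∣ [] [] d = refl
∣p∪q∣≡∣p∣+∣q∣ (outside ∷ p) (outside ∷ q) d = ∣p∪q∣≡∣p∣+∣q∣ p q (λ a b → d (there a) (there b))
∣p∪q∣≡∣p∣+∣q∣ (outside ∷ p) (inside ∷ q)  d = trans (cong suc (∣p∪q∣≡∣p∣+∣q∣ p q (λ a b → d (there a) (there b)))) (sym (+-suc _ _))
∣p∪q∣≡∣p∣+∣q∣ (inside ∷ p) (outside ∷ q)  d = cong suc (∣p∪q∣≡∣p∣+∣q∣ p q (λ a b → d (there a) (there b)))
∣p∪q∣≡∣p∣+∣q∣ (inside ∷ p) (inside ∷ q)   d = ⊥-elim (d here here)

∣p∣≥1⇒nonempty : ∀ {n} {p : Subset n} → 1 ≤ ∣ p ∣ → Nonempty p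
∣p∣≥1⇒nonempty {n} {p} 1≤ with nonempty? p
... | yes ne = ne
... | no em  = contradiction 1≤ (<⇒≱ (≤-reflexive (cong suc (trans (cong ∣_∣ (Empty-unique em)) (∣⊥∣≡0 n)))))

module _ {n : ℕ} where

  x∈p-y⁻ : ∀ {p : Subset n} {x y} → x ∈ p - y → x ∈ p × x ≢ y
  x∈p-y⁻ {p} {x} {y} x∈ with x∈p─q⁻ p ⁅ y ⁆ x∈
  ... | x∈p , x∉ = x∈p , x∉⁅y⁆⇒x≢y x∉

  x∉p-x : ∀ {p : Subset n} {x} → x ∉ p - x
  x∉p-x x∈ = proj₂ (x∈p-y⁻ x∈) refl

  infixl 5 _⊕_
  _⊕_ : Subset n → Fin n → Subset n
  p ⊕ x = p ∪ ⁅ x ⁆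

  p⊆p⊕x : ∀ {p : Subset n} {x} → p ⊆ p ⊕ x
  p⊆p⊕x = x∈p∪q⁺ ∘ inj₁

  x∈p⊕x : ∀ {p : Subset n} {x} → x ∈ p ⊕ x
  x∈p⊕x {x = x} = x∈p∪q⁺ (inj₂ (x∈⁅x⁆ x))

  y∈p⊕x⁻ : ∀ {p : Subset n} {x y} → y ∈ p ⊕ x → y ∈ p ⊎ y ≡ x
  y∈p⊕x⁻ {p} {x} y∈ with x∈p∪q⁻ p ⁅ x ⁆ y∈
  ... | inj₁ y∈p = inj₁ y∈p
  ... | inj₂ y∈x = inj₂ (x∈⁅y⁆⇒x≡y x y∈x)

  p⊕x⊆q : ∀ {p q : Subset n} {x} → p ⊆ q → x ∈ q → p ⊕ x ⊆ q
  p⊕x⊆q p⊆q x∈q y∈ with y∈p⊕x⁻ y∈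
  ... | inj₁ y∈p  = p⊆q y∈p
  ... | inj₂ refl = x∈q

  p-x⊕x≡p : ∀ {p : Subset n} {x} → x ∈ p → p - x ⊕ x ≡ p
  p-x⊕x≡p {p} {x} x∈p = ⊆-antisym (p⊕x⊆q (proj₁ ∘ x∈p-y⁻) x∈p) to
    where
    to : p ⊆ p - x ⊕ x
    to {y} y∈p with y Fin.≟ x
    ... | yes refl = x∈p⊕x
    ... | no y≢x   = p⊆p⊕x (x∈p∧x≢y⇒x∈p-y y∈p y≢x)

  p⊕x-x≡p : ∀ {p : Subset n} {x} → x ∉ p → p ⊕ x - x ≡ p
  p⊕x-x≡p {p} {x} x∉p = ⊆-antisym from (λ y∈p → x∈p∧x≢y⇒x∈p-y (p⊆p⊕x y∈p) λ { refl → x∉p y∈p })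
    where
    from : p ⊕ x - x ⊆ p
    from y∈ with x∈p-y⁻ y∈
    ... | y∈⊕ , y≢x with y∈p⊕x⁻ y∈⊕
    ...   | inj₁ y∈p = y∈p
    ...   | inj₂ y≡x = contradiction y≡x y≢x

  ∣p⊕x∣ : ∀ {p : Subset n} {x} → x ∉ p → ∣ p ⊕ x ∣ ≡ suc ∣ p ∣
  ∣p⊕x∣ {p} {x} x∉p = begin
    ∣ p ⊕ x ∣            ≡⟨ ∣p∪q∣≡∣p∣+∣q∣ p ⁅ x ⁆ (λ y∈p y∈x → x∉p (subst (_∈ p) (x∈⁅y⁆⇒x≡y x y∈x) y∈p)) ⟩
    ∣ p ∣ + ∣ ⁅ x ⁆ ∣    ≡⟨ cong (∣ p ∣ +_) (∣⁅x⁆∣≡1 x) ⟩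
    ∣ p ∣ + 1            ≡⟨ +-comm ∣ p ∣ 1 ⟩
    suc ∣ p ∣            ∎
    where open ≡-Reasoning

  ∣p-x∣ : ∀ {p : Subset n} {x} → x ∈ p → suc ∣ p - x ∣ ≡ ∣ p ∣
  ∣p-x∣ {p} {x} x∈p = trans (sym (∣p⊕x∣ {p - x} {x} (x∉p-x {p}))) (cong ∣_∣ (p-x⊕x≡p x∈p))

  ⊆∧∣∣≥⇒≡ : ∀ {p q : Subset n} → p ⊆ q → ∣ q ∣ ≤ ∣ p ∣ → p ≡ q
  ⊆∧∣∣≥⇒≡ {p} {q} p⊆q q≤p = ⊆-antisym p⊆q q⊆p
    where
    q⊆p : q ⊆ p
    q⊆p {x} x∈q with x ∈? p
    ... | yes x∈p = x∈p
    ... | no x∉p  = contradiction q≤p (<⇒≱ (p⊂q⇒∣p∣<∣q∣ (p⊆q , x , x∈q , x∉p)))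

-- Flexible sets and centers

length-concatMap-≤ : ∀ {A B : Set} (f : A → List B) c xs → (∀ x → length (f x) ≤ c) →
  length (concatMap f xs) ≤ length xs * c
length-concatMap-≤ f c []       f≤c = z≤n
length-concatMap-≤ f c (x ∷ xs) f≤c = ≤-trans
  (≤-reflexive (List.length-++ (f x)))
  (+-mono-≤ (f≤c x) (length-concatMap-≤ f c xs f≤c))

-- Writing the uniformity as `3 + j` builds in k ≥ 3.
module Structure (n j : ℕ) (𝓕 : Family n (3 + j)) (free : ClusterFree 3 𝓕) where

  k : ℕ
  k = 3 + j

  ∣∣≡k : ∀ {F} → F ∈ᶠ 𝓕 → ∣ F ∣ ≡ k
  ∣∣≡k F∈ = All.lookup (Family.uniform 𝓕) F∈

  no-cluster : ∀ {F G H} → F ∈ᶠ 𝓕 → G ∈ᶠ 𝓕 → H ∈ᶠ 𝓕 → F ≢ G → F ≢ H → G ≢ H →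
    (∀ {v} → v ∈ F → v ∈ G ⊎ v ∈ H) → (∀ {v} → v ∈ F → v ∈ G → v ∉ H) → Absurd
  no-cluster {F} {G} {H} F∈ G∈ H∈ F≢G F≢H G≢H cover empty = free (F ∷ G ∷ H ∷ [] , record
    { count        = refl
    ; different    = (F≢G ∷ F≢H ∷ []) ∷ (G≢H ∷ []) ∷ [] ∷ []
    ; uniform      = ∣∣≡k F∈ ∷ ∣∣≡k G∈ ∷ ∣∣≡k H∈ ∷ []
    ; small-union  = small
    ; empty-common = λ { (v , v∈) → let v∈F , v∈GH = x∈p∩q⁻ F _ v∈
                                        v∈G , v∈H⊤ = x∈p∩q⁻ G _ v∈GH
                                    in empty v∈F v∈G (proj₁ (x∈p∩q⁻ H _ v∈H⊤)) }
    } , F∈ ∷ G∈ ∷ H∈ ∷ [])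
    where
    to : ⋃ (F ∷ G ∷ H ∷ []) ⊆ G ∪ H
    to v∈ with x∈p∪q⁻ F _ v∈
    ... | inj₁ v∈F = x∈p∪q⁺ (cover v∈F)
    ... | inj₂ v∈GH with x∈p∪q⁻ G _ v∈GH
    ...   | inj₁ v∈G = x∈p∪q⁺ (inj₁ v∈G)
    ...   | inj₂ v∈H⊥ with x∈p∪q⁻ H _ v∈H⊥
    ...     | inj₁ v∈H = x∈p∪q⁺ (inj₂ v∈H)
    ...     | inj₂ v∈⊥ = contradiction v∈⊥ ∉⊥
    small : ∣ ⋃ (F ∷ G ∷ H ∷ []) ∣ ≤ 2 * k
    small = begin
      ∣ ⋃ (F ∷ G ∷ H ∷ []) ∣    ≤⟨ p⊆q⇒∣p∣≤∣q∣ to ⟩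
      ∣ G ∪ H ∣                 ≤⟨ ∣p∪q∣≤∣p∣+∣q∣ {n} G H ⟩
      ∣ G ∣ + ∣ H ∣             ≡⟨ cong₂ _+_ (∣∣≡k G∈) (trans (∣∣≡k H∈) (sym (+-identityʳ k))) ⟩
      2 * k                     ∎
      where open ≤-Reasoning

  ≢-witness : ∀ {F G : Subset n} {v} → v ∈ F → v ∉ G → F ≢ G
  ≢-witness v∈F v∉G refl = v∉G v∈F

  Blocks : Subset n → Subset n → Set
  Blocks S W = ∣ W ∣ ≤ k × Empty (W ∩ S) × All (λ G → S ⊆ G → Nonempty (W ∩ G)) (Family.members 𝓕)

  blocks? : ∀ S → Decidable (Blocks S)
  blocks? S W = (∣ W ∣ ≤? k) ×-dec ¬? (nonempty? (W ∩ S)) ×-dec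
    All.all? (λ G → (S ⊆? G) →-dec nonempty? (W ∩ G)) (Family.members 𝓕)

  -- The absence of a blocking set is decided by a search through all subsets; `avoid` recovers the
  -- positive form.
  Flexible : Subset n → Set
  Flexible S = ¬ ∃ (Blocks S)

  flexible? : Decidable Flexible
  flexible? S = ¬? (anySubset? (blocks? S))

  -- If every member containing `S` met `W`, then `W` would block `S`. The members form a finite
  -- list, so the failure of this yields an actual member.
  avoid : ∀ {S} → Flexible S → ∀ W → ∣ W ∣ ≤ k → (∀ {v} → v ∈ W → v ∉ S) →
    ∃[ G ] (G ∈ᶠ 𝓕 × S ⊆ G × (∀ {v} → v ∈ W → v ∉ G))
  avoid {S} flex W W≤k disj
    with All.all? (λ G → (S ⊆? G) →-dec nonempty? (W ∩ G)) (Family.members 𝓕)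
  ... | yes all = contradiction (W , W≤k , (λ { (v , v∈) → let a , b = x∈p∩q⁻ W S v∈ in disj a b }) , all) flex
  ... | no ¬all with find (¬All⇒Any¬ (λ G → (S ⊆? G) →-dec nonempty? (W ∩ G)) _ ¬all)
  ...   | G , G∈ , ¬imp = G , G∈ ,
          decidable-stable (S ⊆? G) (λ S⊈G → ¬imp (λ S⊆G → ⊥-elim (S⊈G S⊆G))) ,
          (λ v∈W v∈G → ¬imp (λ _ → _ , x∈p∩q⁺ (v∈W , v∈G)))

  -- The vertices of the blocking set fixed for `S`; the search acts as the choice function.
  hits : Subset n → List (Fin n)
  hits S with anySubset? (blocks? S)
  ... | yes (W , _) = elements W
  ... | no _        = []

  length-hits : ∀ S → length (hits S) ≤ k
  length-hits S with anySubset? (blocks? S)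
  ... | yes (W , W≤k , _) = ≤-trans (≤-reflexive (∣elements∣ W)) W≤k
  ... | no _              = z≤n

  hits-block : ∀ {S} → ¬ Flexible S → ∃[ W ] (Blocks S W × (∀ {v} → v ∈ W → v ∈ˡ hits S))
  hits-block {S} ¬flex with anySubset? (blocks? S)
  ... | yes (W , b) = W , b , λ v∈W → ∈-filter⁺ (_∈? W) (∈-allFin _) v∈W
  ... | no ¬b       = contradiction ¬b ¬flex

  hit : ∀ {S F} → ¬ Flexible S → F ∈ᶠ 𝓕 → S ⊆ F → ∃[ y ] (y ∈ˡ hits S × y ∈ F × y ∉ S)
  hit {S} {F} ¬flex F∈ S⊆F with hits-block ¬flex
  ... | W , (_ , disj , all) , W⊆hits with All.lookup all F∈ S⊆F
  ...   | y , y∈ with x∈p∩q⁻ W F y∈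
  ...     | y∈W , y∈F = y , W⊆hits y∈W , y∈F , λ y∈S → disj (y , x∈p∩q⁺ (y∈W , y∈S))

  -- A bad set F ⊇ S ∪ {y, z} is recovered from F - z - y, S and the positions of y and z among the hits.
  codes-at : Subset n → Subset n → Fin n → List (Subset n)
  codes-at Q S y = map (λ z → Q ⊕ y ⊕ z) (hits S ++ hits (S ⊕ y))

  codes : Subset n → List (Subset n)
  codes Q = concatMap (λ S → concatMap (codes-at Q S) (hits S)) (filter (_⊆? Q) (subsets n))

  -- There are `2 ^ ∣ Q ∣` choices of `S`, at most `k` of `y`, and at most `k + k` of `z`, which
  -- comes from one of two lists of hits.
  length-codes : ∀ Q → length (codes Q) ≤ 2 ^ ∣ Q ∣ * (k * (k + k))
  length-codes Q = ≤-trans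
    (length-concatMap-≤ (λ S → concatMap (codes-at Q S) (hits S)) (k * (k + k)) (filter (_⊆? Q) (subsets n)) inner)
    (≤-reflexive (cong (_* (k * (k + k))) (trans (length-filter≡count (_⊆? Q) (subsets n)) (#subsets Q))))
    where
    inner : ∀ S → length (concatMap (codes-at Q S) (hits S)) ≤ k * (k + k)
    inner S = ≤-trans
      (length-concatMap-≤ (codes-at Q S) (k + k) (hits S)
        (λ y → ≤-trans (≤-reflexive (trans (List.length-map _ (hits S ++ _)) (List.length-++ (hits S))))
                 (+-mono-≤ (length-hits S) (length-hits (S ⊕ y)))))
      (*-monoˡ-≤ (k + k) (length-hits S))

  -- Here `1 + j` is k - 2. Defining badness by being coded makes bad sets easy to count;
  -- `bad-intro` shows that both kinds of bad members are covered.
  Bad : Subset n → Set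
  Bad F = ∃[ Q ] (∣ Q ∣ ≡ 1 + j × F ∈ˡ codes Q)

  bad? : Decidable Bad
  bad? F = anySubset? (λ Q → (∣ Q ∣ ≟ 1 + j) ×-dec (F ∈ˡ? codes Q))

  -- The two kinds of badness differ in the list that supplies `z`: the hits of `S` when one
  -- blocking set meets `F` twice, the hits of `S ⊕ y` when `S ⊕ y` is inflexible as well.
  bad-intro : ∀ {F S y z} → F ∈ᶠ 𝓕 → S ⊆ F → y ∈ F → z ∈ F → y ∉ S → z ∉ S → z ≢ y →
    y ∈ˡ hits S → z ∈ˡ hits S ++ hits (S ⊕ y) → Bad F
  bad-intro {F} {S} {y} {z} F∈ S⊆F y∈F z∈F y∉S z∉S z≢y y∈h z∈h = Q , ∣Q∣ , F∈codes
    where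
    Q = F - z - y
    y∈F-z : y ∈ F - z
    y∈F-z = x∈p∧x≢y⇒x∈p-y y∈F (z≢y ∘ sym)
    ∣Q∣ : ∣ Q ∣ ≡ 1 + j
    ∣Q∣ = suc-injective (suc-injective (begin
      2 + ∣ Q ∣             ≡⟨ cong suc (∣p-x∣ {p = F - z} y∈F-z) ⟩
      suc (∣ F - z ∣)       ≡⟨ ∣p-x∣ {p = F} z∈F ⟩
      ∣ F ∣                 ≡⟨ ∣∣≡k F∈ ⟩
      k                     ∎))
      where open ≡-Reasoning
    S⊆Q : S ⊆ Q
    S⊆Q v∈S = x∈p∧x≢y⇒x∈p-y (x∈p∧x≢y⇒x∈p-y (S⊆F v∈S) λ { refl → z∉S v∈S }) λ { refl → y∉S v∈S }
    eq : F ≡ Q ⊕ y ⊕ z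
    eq = sym (trans (cong (_⊕ z) (p-x⊕x≡p {p = F - z} y∈F-z)) (p-x⊕x≡p {p = F} z∈F))
    F∈codes : F ∈ˡ codes Q
    F∈codes = ∈-concatMap⁺ (λ S → concatMap (codes-at Q S) (hits S))
      (Any.map (λ { refl → ∈-concatMap⁺ (codes-at Q S)
                    (Any.map (λ { refl → subst (_∈ˡ codes-at Q S y) (sym eq) (∈-map⁺ (λ z → Q ⊕ y ⊕ z) z∈h) }) y∈h) })
        (∈-filter⁺ (_⊆? Q) (∈-subsets S) S⊆Q))

  -- Closure of the flexible subsets of F under intersection, one excluded vertex at a time.
  flexible-from : ∀ {F S} → F ∈ᶠ 𝓕 → ¬ Bad F → S ⊆ F →
    (∀ {y} → y ∈ F → y ∉ S → ∃[ T ] (Flexible T × S ⊆ T × T ⊆ F × y ∉ T)) → Flexible S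
  flexible-from {F} {S} F∈ good S⊆F f = decidable-stable (flexible? S) step
    where
    step : ¬ ¬ Flexible S
    step ¬flex with hits-block ¬flex
    ... | W , (W≤k , disj , all) , W⊆hits with All.lookup all F∈ S⊆F
    ...   | y , y∈ with x∈p∩q⁻ W F y∈
    ...     | y∈W , y∈F with f y∈F (λ y∈S → disj (y , x∈p∩q⁺ (y∈W , y∈S)))
    ...       | T , flexT , S⊆T , T⊆F , y∉T with avoid flexT W W≤k W∩T
      where
      ∉S : ∀ {v} → v ∈ W → v ∉ S
      ∉S v∈W v∈S = disj (_ , x∈p∩q⁺ (v∈W , v∈S))
      -- Since `F` is good, `y` is the only vertex of `W` in `F`, and `T` omits it. So flexibility
      -- of `T` gives a member that contains `S` and misses `W`, although `W` blocks `S`.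
      W∩T : ∀ {v} → v ∈ W → v ∉ T
      W∩T v∈W v∈T = good (bad-intro F∈ S⊆F y∈F (T⊆F v∈T) (∉S y∈W) (∉S v∈W)
        (λ { refl → y∉T v∈T }) (W⊆hits y∈W) (∈-++⁺ˡ (W⊆hits v∈W)))
    ...         | G , G∈ , T⊆G , W∩G with All.lookup all G∈ (T⊆G ∘ S⊆T)
    ...           | v , v∈ = let v∈W , v∈G = x∈p∩q⁻ W G v∈ in W∩G v∈W v∈G

  -- A blocking set of `F - a - b` meets `F` at `a` or `b`. Adding that vertex gives `F - b` or
  -- `F - a`, which is inflexible again: the second kind of badness.
  flexible-pair : ∀ {F a b} → F ∈ᶠ 𝓕 → ¬ Bad F → a ∈ F → b ∈ F → a ≢ b →
    ¬ Flexible (F - a) → ¬ Flexible (F - b) → Flexible (F - a - b)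
  flexible-pair {F} {a} {b} F∈ good a∈ b∈ a≢b ¬a ¬b = decidable-stable (flexible? (F - a - b)) step
    where
    S = F - a - b
    S⊆F : S ⊆ F
    S⊆F = proj₁ ∘ x∈p-y⁻ ∘ proj₁ ∘ x∈p-y⁻
    only : ∀ {v} → v ∈ F → v ∉ S → v ≡ a ⊎ v ≡ b
    only {v} v∈F v∉S with v Fin.≟ a | v Fin.≟ b
    ... | yes e | _     = inj₁ e
    ... | no _  | yes e = inj₂ e
    ... | no na | no nb = contradiction (x∈p∧x≢y⇒x∈p-y (x∈p∧x≢y⇒x∈p-y v∈F na) nb) v∉S
    a∉S : a ∉ S
    a∉S a∈S = proj₂ (x∈p-y⁻ (proj₁ (x∈p-y⁻ a∈S))) refl
    b∉S : b ∉ S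
    b∉S b∈S = proj₂ (x∈p-y⁻ b∈S) refl
    S+b : S ⊕ b ≡ F - a
    S+b = p-x⊕x≡p {p = F - a} (x∈p∧x≢y⇒x∈p-y b∈ (a≢b ∘ sym))
    S+a : S ⊕ a ≡ F - b
    S+a = trans (cong (_⊕ a) (p─x─y≡p─y─x F a b)) (p-x⊕x≡p {p = F - b} (x∈p∧x≢y⇒x∈p-y a∈ a≢b))
    second : ∀ {y} → y ∈ F → y ∉ S → y ∈ˡ hits S → ¬ Flexible (S ⊕ y) → Absurd
    second {y} y∈F y∉S y∈h ¬flex with hit ¬flex F∈ (p⊕x⊆q S⊆F y∈F)
    ... | z , z∈h , z∈F , z∉ = good (bad-intro F∈ S⊆F y∈F z∈F y∉S (z∉ ∘ p⊆p⊕x)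
            (λ { refl → z∉ x∈p⊕x }) y∈h (∈-++⁺ʳ (hits S) z∈h))
    step : ¬ ¬ Flexible S
    step ¬flex with hit ¬flex F∈ S⊆F
    ... | y , y∈h , y∈F , y∉S with only y∈F y∉S
    ...   | inj₁ refl = second a∈ a∉S y∈h (subst (¬_ ∘ Flexible) (sym S+a) ¬b)
    ...   | inj₂ refl = second b∈ b∉S y∈h (subst (¬_ ∘ Flexible) (sym S+b) ¬a)

  -- A member containing `S` and avoiding `T`, and one containing `T` and avoiding `S`, form a
  -- cluster with `F`. The vertices `a` and `b` tell the three sets apart.
  not-both-flexible : ∀ {F S T a b} → F ∈ᶠ 𝓕 → a ∈ S → b ∈ T → S ⊆ F → T ⊆ F →
    (∀ {v} → v ∈ S → v ∉ T) → (∀ {v} → v ∈ F → v ∈ S ⊎ v ∈ T) → Flexible S → Flexible T → Absurd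
  not-both-flexible {F} {S} {T} F∈ a∈S b∈T S⊆F T⊆F disj cover flexS flexT
    with avoid flexS T (≤-trans (p⊆q⇒∣p∣≤∣q∣ T⊆F) (≤-reflexive (∣∣≡k F∈))) (λ v∈T v∈S → disj v∈S v∈T)
       | avoid flexT S (≤-trans (p⊆q⇒∣p∣≤∣q∣ S⊆F) (≤-reflexive (∣∣≡k F∈))) disj
  ... | G , G∈ , S⊆G , T∩G | H , H∈ , T⊆H , S∩H =
    no-cluster F∈ G∈ H∈ (≢-witness (T⊆F b∈T) (T∩G b∈T)) (≢-witness (S⊆F a∈S) (S∩H a∈S))
      (≢-witness (S⊆G a∈S) (S∩H a∈S)) (covered ∘ cover)
      (λ v∈F v∈G v∈H → [∉] (cover v∈F) v∈G v∈H)
    where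
    covered : ∀ {v} → v ∈ S ⊎ v ∈ T → v ∈ G ⊎ v ∈ H
    covered (inj₁ v∈S) = inj₁ (S⊆G v∈S)
    covered (inj₂ v∈T) = inj₂ (T⊆H v∈T)
    [∉] : ∀ {v} → v ∈ S ⊎ v ∈ T → v ∈ G → v ∉ H
    [∉] (inj₁ v∈S) _ v∈H = S∩H v∈S v∈H
    [∉] (inj₂ v∈T) v∈G _ = T∩G v∈T v∈G

  Center : Subset n → Fin n → Set
  Center F x = ¬ (∃[ S ] (x ∈ S × S ⊆ F × ¬ Flexible S))

  center? : ∀ F x → Dec (Center F x)
  center? F x = ¬? (anySubset? (λ S → (x ∈? S) ×-dec (S ⊆? F) ×-dec ¬? (flexible? S)))

  center-flexible : ∀ {F x} → Center F x → ∀ {S} → x ∈ S → S ⊆ F → Flexible S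
  center-flexible c {S} x∈S S⊆F = decidable-stable (flexible? S) (λ ¬flex → c (S , x∈S , S⊆F , ¬flex))

  ⁅x⁆⊆ : ∀ {F : Subset n} {x} → x ∈ F → ⁅ x ⁆ ⊆ F
  ⁅x⁆⊆ {F} {x} x∈F v∈ = subst (_∈ F) (sym (x∈⁅y⁆⇒x≡y x v∈)) x∈F

  element-outside : ∀ {F : Subset n} A → ∣ A ∣ < ∣ F ∣ → ∃[ v ] (v ∈ F × v ∉ A)
  element-outside {F} A A<F with Fin.any? (λ v → (v ∈? F) ×-dec ¬? (v ∈? A))
  ... | yes w = w
  ... | no ¬w = contradiction (p⊆q⇒∣p∣≤∣q∣ {p = F} {q = A}
          (λ {v} v∈F → decidable-stable (v ∈? A) (λ v∉A → ¬w (v , v∈F , v∉A)))) (<⇒≱ A<F)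

  other-element : ∀ {F : Subset n} → 2 ≤ ∣ F ∣ → ∀ a → ∃[ v ] (v ∈ F × v ≢ a)
  other-element {F} 2≤ a =
    let v , v∈F , v∉a = element-outside {F} ⁅ a ⁆ (≤-trans (s≤s (≤-reflexive (∣⁅x⁆∣≡1 a))) 2≤)
    in v , v∈F , x∉⁅y⁆⇒x≢y v∉a

  -- For a member `F`, the facet `F - r` then lies in no other member, by `own-facet-unique`.
  Own : Subset n → Fin n → Set
  Own F r = r ∈ F × Flexible ⁅ r ⁆

  TwoOwn : Subset n → Set
  TwoOwn F = ∃[ p ] ∃[ q ] (p ≢ q × Own F p × Own F q)

  -- Rigid vertices of a good member

  module _ {F} (F∈ : F ∈ᶠ 𝓕) (good : ¬ Bad F) where

    Rigid : Fin n → Set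
    Rigid x = x ∈ F × ¬ Flexible (F - x)

    other-rigid? : ∀ A → (∃[ x ] (Rigid x × x ∉ A)) ⊎ (∀ {x} → x ∈ F → x ∉ A → Flexible (F - x))
    other-rigid? A with Fin.any? (λ x → ((x ∈? F) ×-dec ¬? (flexible? (F - x))) ×-dec ¬? (x ∈? A))
    ... | yes w = inj₁ w
    ... | no ¬w = inj₂ λ {x} x∈F x∉A → decidable-stable (flexible? (F - x)) (λ ¬f → ¬w (x , (x∈F , ¬f) , x∉A))

    -- `S` is the intersection of the facets `F - y` over the vertices `y` of `F` outside `S`.
    from-facets : ∀ {S} → S ⊆ F → (∀ {y} → y ∈ F → y ∉ S → Flexible (F - y)) → Flexible S
    from-facets {S} S⊆F f = flexible-from F∈ good S⊆F λ {y} y∈F y∉S →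
      F - y , f y∈F y∉S , (λ v∈S → x∈p∧x≢y⇒x∈p-y (S⊆F v∈S) λ { refl → y∉S v∈S }) ,
      proj₁ ∘ x∈p-y⁻ , x∉p-x {p = F}

    -- If all facets were flexible, all their intersections would be, in particular a singleton and
    -- its complement in `F`.
    some-rigid : ∃ Rigid
    some-rigid with other-rigid? ⊥
    ... | inj₁ (x , r , _) = x , r
    ... | inj₂ all with ∣p∣≥1⇒nonempty {p = F} (≤-trans (s≤s z≤n) (≤-reflexive (sym (∣∣≡k F∈))))
    ...   | a , a∈F with other-element {F} (≤-trans (s≤s (s≤s z≤n)) (≤-reflexive (sym (∣∣≡k F∈)))) a
    ...     | b , b∈F , b≢a = ⊥-elim (not-both-flexible F∈ (x∈⁅x⁆ a) (x∈p∧x≢y⇒x∈p-y b∈F b≢a)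
                (⁅x⁆⊆ a∈F) (proj₁ ∘ x∈p-y⁻) (λ v∈a v∈ → proj₂ (x∈p-y⁻ v∈) (x∈⁅y⁆⇒x≡y a v∈a)) cover
                (from-facets (⁅x⁆⊆ a∈F) (λ y∈F _ → all y∈F ∉⊥)) (all a∈F ∉⊥))
      where
      cover : ∀ {v} → v ∈ F → v ∈ ⁅ a ⁆ ⊎ v ∈ F - a
      cover {v} v∈F with v Fin.≟ a
      ... | yes refl = inj₁ (x∈⁅x⁆ a)
      ... | no v≢a   = inj₂ (x∈p∧x≢y⇒x∈p-y v∈F v≢a)

    -- If `x` and `p` were the only rigid vertices, the pair would be an intersection of flexible
    -- facets, while its complement is flexible by `flexible-pair`.
    third-rigid : ∀ {x p} → Rigid x → Rigid p → x ≢ p → ∃[ q ] (Rigid q × q ≢ x × q ≢ p)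
    third-rigid {x} {p} (x∈F , ¬x) (p∈F , ¬p) x≢p with other-rigid? (⁅ x ⁆ ⊕ p)
    ... | inj₁ (q , r , q∉) = q , r , (λ { refl → q∉ (p⊆p⊕x (x∈⁅x⁆ x)) }) , (λ { refl → q∉ (x∈p⊕x {p = ⁅ x ⁆}) })
    -- Because k ≥ 3, the complement of the pair in `F` has a vertex.
    ... | inj₂ all with element-outside {F} (⁅ x ⁆ ⊕ p)
            (≤-trans (s≤s (≤-reflexive (trans (∣p⊕x∣ {p = ⁅ x ⁆} (x≢y⇒x∉⁅y⁆ (x≢p ∘ sym))) (cong suc (∣⁅x⁆∣≡1 x)))))
              (≤-trans (s≤s (s≤s (s≤s z≤n))) (≤-reflexive (sym (∣∣≡k F∈)))))
    ...   | b , b∈F , b∉ = ⊥-elim (not-both-flexible F∈ (x∈p⊕x {p = ⁅ x ⁆}) (outside-pair b∈F b∉) pair⊆F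
                (proj₁ ∘ x∈p-y⁻ ∘ proj₁ ∘ x∈p-y⁻) disj cover
                (from-facets pair⊆F all) (flexible-pair F∈ good x∈F p∈F x≢p ¬x ¬p))
      where
      pair⊆F : ⁅ x ⁆ ⊕ p ⊆ F
      pair⊆F = p⊕x⊆q (⁅x⁆⊆ x∈F) p∈F
      outside-pair : ∀ {v} → v ∈ F → v ∉ ⁅ x ⁆ ⊕ p → v ∈ F - x - p
      outside-pair v∈F v∉ = x∈p∧x≢y⇒x∈p-y (x∈p∧x≢y⇒x∈p-y v∈F (λ { refl → v∉ (p⊆p⊕x (x∈⁅x⁆ x)) }))
        (λ { refl → v∉ (x∈p⊕x {p = ⁅ x ⁆}) })
      disj : ∀ {v} → v ∈ ⁅ x ⁆ ⊕ p → v ∉ F - x - p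
      disj v∈ v∈F with x∈p-y⁻ v∈F | y∈p⊕x⁻ {p = ⁅ x ⁆} v∈
      ... | _ , v≢p    | inj₂ v≡p = v≢p v≡p
      ... | v∈F-x , _  | inj₁ v∈x = proj₂ (x∈p-y⁻ v∈F-x) (x∈⁅y⁆⇒x≡y x v∈x)
      cover : ∀ {v} → v ∈ F → v ∈ ⁅ x ⁆ ⊕ p ⊎ v ∈ F - x - p
      cover {v} v∈F with v ∈? (⁅ x ⁆ ⊕ p)
      ... | yes v∈ = inj₁ v∈
      ... | no v∉  = inj₂ (outside-pair v∈F v∉)

    -- Each other vertex `y` has to be excluded by a flexible set containing `x`: the facet `F - y`
    -- if it is flexible, and otherwise `F` without `y` and a second rigid vertex, which is `p`, or
    -- `q` when `y` is `p`.
    rigid-flexible : ∀ {x p q} → Rigid x → Rigid p → Rigid q → x ≢ p → q ≢ x → q ≢ p → Flexible ⁅ x ⁆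
    rigid-flexible {x} {p} {q} (x∈F , _) (p∈F , ¬p) (q∈F , ¬q) x≢p q≢x q≢p =
      flexible-from F∈ good (⁅x⁆⊆ x∈F) avoiding
      where
      via-pair : ∀ {y r} → Rigid y → Rigid r → y ≢ r → y ≢ x → r ≢ x →
        ∃[ T ] (Flexible T × ⁅ x ⁆ ⊆ T × T ⊆ F × y ∉ T)
      via-pair {y} {r} (y∈F , ¬y) (r∈F , ¬r) y≢r y≢x r≢x = F - y - r ,
        flexible-pair F∈ good y∈F r∈F y≢r ¬y ¬r ,
        ⁅x⁆⊆ (x∈p∧x≢y⇒x∈p-y (x∈p∧x≢y⇒x∈p-y x∈F (y≢x ∘ sym)) (r≢x ∘ sym)) ,
        proj₁ ∘ x∈p-y⁻ ∘ proj₁ ∘ x∈p-y⁻ , λ y∈ → x∉p-x {p = F} (proj₁ (x∈p-y⁻ y∈))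
      avoiding : ∀ {y} → y ∈ F → y ∉ ⁅ x ⁆ → ∃[ T ] (Flexible T × ⁅ x ⁆ ⊆ T × T ⊆ F × y ∉ T)
      avoiding {y} y∈F y∉x with flexible? (F - y)
      ... | yes flex = F - y , flex , ⁅x⁆⊆ (x∈p∧x≢y⇒x∈p-y x∈F (x∉⁅y⁆⇒x≢y y∉x ∘ sym)) , proj₁ ∘ x∈p-y⁻ , x∉p-x {p = F}
      ... | no ¬flex with y Fin.≟ p
      ...   | yes refl = via-pair (p∈F , ¬p) (q∈F , ¬q) (q≢p ∘ sym) (x≢p ∘ sym) q≢x
      ...   | no y≢p   = via-pair (y∈F , ¬flex) (p∈F , ¬p) y≢p (x∉⁅y⁆⇒x≢y y∉x) (x≢p ∘ sym)

    -- A single rigid vertex is a center, since every subset containing it is an intersection of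
    -- flexible facets. Two rigid vertices force a third, and then rigid vertices are flexible as
    -- singletons.
    good-dichotomy : (∃[ x ] (x ∈ F × Center F x)) ⊎ TwoOwn F
    good-dichotomy with some-rigid
    ... | x , rx@(x∈F , _) with other-rigid? ⁅ x ⁆
    ...   | inj₂ all = inj₁ (x , x∈F , λ { (S , x∈S , S⊆F , ¬flex) →
              ¬flex (from-facets S⊆F (λ y∈F y∉S → all y∈F (λ y∈x → y∉S (subst (_∈ S) (sym (x∈⁅y⁆⇒x≡y x y∈x)) x∈S)))) })
    ...   | inj₁ (p , rp@(p∈F , _) , p∉x) with x∉⁅y⁆⇒x≢y p∉x
    ...     | p≢x with third-rigid rx rp (p≢x ∘ sym)
    ...       | q , rq , q≢x , q≢p = inj₂ (x , p , p≢x ∘ sym ,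
                  (x∈F , rigid-flexible rx rp rq (p≢x ∘ sym) q≢x q≢p) ,
                  (p∈F , rigid-flexible rp rx rq p≢x q≢p q≢x))

  -- If `r` lies in `F′`, it must be `r′`. Otherwise a member through `r` that avoids `F′` forms a
  -- cluster with `F` and `F′`, because `F` exceeds `F′` only by `r`.
  own-facet-unique : ∀ {F F′ r r′} → F ∈ᶠ 𝓕 → F′ ∈ᶠ 𝓕 → Own F r → r′ ∈ F′ → F - r ≡ F′ - r′ → F ≡ F′
  own-facet-unique {F} {F′} {r} {r′} F∈ F′∈ (r∈F , flex) r′∈F′ eq with r ∈? F′
  ... | yes r∈F′ = trans (trans (sym (p-x⊕x≡p {p = F} r∈F)) (cong₂ _⊕_ eq r≡r′)) (p-x⊕x≡p {p = F′} r′∈F′)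
    where
    r≡r′ : r ≡ r′
    r≡r′ = decidable-stable (r Fin.≟ r′) λ r≢r′ →
      x∉p-x {p = F} (subst (r ∈_) (sym eq) (x∈p∧x≢y⇒x∈p-y r∈F′ r≢r′))
  ... | no r∉F′ with avoid flex F′ (≤-reflexive (∣∣≡k F′∈)) (λ v∈F′ v∈r → r∉F′ (subst (_∈ F′) (x∈⁅y⁆⇒x≡y r v∈r) v∈F′))
  ...   | H , H∈ , r⊆H , F′∩H = ⊥-elim (no-cluster F∈ F′∈ H∈ (≢-witness r∈F r∉F′)
            F≢H (≢-witness r′∈F′ (F′∩H r′∈F′)) cover (λ _ → F′∩H))
    where
    ⊆F′ : F - r ⊆ F′
    ⊆F′ v∈ = proj₁ (x∈p-y⁻ (subst (_ ∈_) eq v∈))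
    cover : ∀ {v} → v ∈ F → v ∈ F′ ⊎ v ∈ H
    cover {v} v∈F with v Fin.≟ r
    ... | yes refl = inj₂ (r⊆H (x∈⁅x⁆ r))
    ... | no v≢r   = inj₁ (⊆F′ (x∈p∧x≢y⇒x∈p-y v∈F v≢r))
    F≢H : F ≢ H
    F≢H with other-element {F} (≤-trans (s≤s (s≤s z≤n)) (≤-reflexive (sym (∣∣≡k F∈)))) r
    ... | b , b∈F , b≢r = ≢-witness b∈F (F′∩H (⊆F′ (x∈p∧x≢y⇒x∈p-y b∈F b≢r)))

  -- If `x ≢ x′`, then `X = F - x′ - u` contains `x` and `Y`, the pair of `u` and `x′`, contains
  -- `x′`, so both are flexible. They are disjoint and cover `F`, whether or not `x′` is in `F`, and
  -- members extending one and avoiding the other form a cluster with `F`.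
  centers-agree : ∀ {F F′ x x′ u} → F ∈ᶠ 𝓕 → F′ ∈ᶠ 𝓕 → x ∈ F → x′ ∈ F′ → Center F x → Center F′ x′ →
    u ∈ F → u ∈ F′ → u ≢ x → u ≢ x′ → x ≡ x′
  centers-agree {F} {F′} {x} {x′} {u} F∈ F′∈ x∈F x′∈F′ cF cF′ u∈F u∈F′ u≢x u≢x′ =
    decidable-stable (x Fin.≟ x′) step
    where
    X : Subset n
    X = F - x′ - u
    Y : Subset n
    Y = ⁅ u ⁆ ⊕ x′
    X⊆F : X ⊆ F
    X⊆F = proj₁ ∘ x∈p-y⁻ ∘ proj₁ ∘ x∈p-y⁻
    X∩Y : ∀ {v} → v ∈ X → v ∉ Y
    X∩Y v∈X v∈Y with x∈p-y⁻ v∈X | y∈p⊕x⁻ {p = ⁅ u ⁆} v∈Y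
    ... | v∈F-x′ , _ | inj₂ v≡x′ = proj₂ (x∈p-y⁻ v∈F-x′) v≡x′
    ... | _ , v≢u    | inj₁ v∈u  = v≢u (x∈⁅y⁆⇒x≡y u v∈u)
    F⊆X∪Y : ∀ {v} → v ∈ F → v ∈ Y ⊎ v ∈ X
    F⊆X∪Y {v} v∈F with v Fin.≟ x′ | v Fin.≟ u
    ... | yes refl | _        = inj₁ (x∈p⊕x {p = ⁅ u ⁆})
    ... | no _     | yes refl = inj₁ (p⊆p⊕x (x∈⁅x⁆ u))
    ... | no v≢x′  | no v≢u   = inj₂ (x∈p∧x≢y⇒x∈p-y (x∈p∧x≢y⇒x∈p-y v∈F v≢x′) v≢u)
    ∣Y∣≤k : ∣ Y ∣ ≤ k
    ∣Y∣≤k = ≤-trans (≤-reflexive (trans (∣p⊕x∣ {p = ⁅ u ⁆} (x≢y⇒x∉⁅y⁆ (u≢x′ ∘ sym))) (cong suc (∣⁅x⁆∣≡1 u)))) (s≤s (s≤s z≤n))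
    step : ¬ ¬ (x ≡ x′)
    step x≢x′ with x∈p∧x≢y⇒x∈p-y (x∈p∧x≢y⇒x∈p-y x∈F x≢x′) (u≢x ∘ sym)
    ... | x∈X with avoid (center-flexible cF′ {Y} (x∈p⊕x {p = ⁅ u ⁆}) (p⊕x⊆q (⁅x⁆⊆ u∈F′) x′∈F′)) X
                     (≤-trans (p⊆q⇒∣p∣≤∣q∣ X⊆F) (≤-reflexive (∣∣≡k F∈))) X∩Y
                 | avoid (center-flexible cF {X} x∈X X⊆F) Y ∣Y∣≤k (λ v∈Y v∈X → X∩Y v∈X v∈Y)
    ...   | G , G∈ , Y⊆G , X∩G | H , H∈ , X⊆H , Y∩H =
      no-cluster F∈ G∈ H∈ (≢-witness x∈F (X∩G x∈X)) (≢-witness u∈F (Y∩H u∈Y))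
        (≢-witness (Y⊆G u∈Y) (Y∩H u∈Y)) (λ v∈F → cover (F⊆X∪Y v∈F)) (λ v∈F → empty (F⊆X∪Y v∈F))
      where
      u∈Y : u ∈ Y
      u∈Y = p⊆p⊕x (x∈⁅x⁆ u)
      cover : ∀ {v} → v ∈ Y ⊎ v ∈ X → v ∈ G ⊎ v ∈ H
      cover (inj₁ v∈Y) = inj₁ (Y⊆G v∈Y)
      cover (inj₂ v∈X) = inj₂ (X⊆H v∈X)
      empty : ∀ {v} → v ∈ Y ⊎ v ∈ X → v ∈ G → v ∉ H
      empty (inj₁ v∈Y) _ v∈H = Y∩H v∈Y v∈H
      empty (inj₂ v∈X) v∈G _ = X∩G v∈X v∈G

  Missing : Fin n → Subset n → Set
  Missing x G = ∣ G ∣ ≡ k × x ∈ G × ¬ (G ∈ᶠ 𝓕)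

  missing? : ∀ x → Decidable (Missing x)
  missing? x G = (∣ G ∣ ≟ k) ×-dec (x ∈? G) ×-dec ¬? (G ∈ᶠ? 𝓕)

-- The frequent label

#size : ∀ n c → # {n} (λ P → ∣ P ∣ ≟ c) ≡ binom n c
#size n c = trans
  (#-cong {n} (λ P → ∣ P ∣ ≟ c) (between? {n} ⊥ ⊤ c)
    (λ P eq → ⊥⊆ , ⊆⊤ , trans eq c≡) (λ P (_ , _ , eq) → trans eq (sym c≡)))
  (#between {n} ⊥ ⊤ n c ⊥⊆ ∣⊤∣≡n+∣⊥∣)
  where
  c≡ : c ≡ c + ∣ ⊥ {n} ∣
  c≡ = trans (sym (+-identityʳ c)) (cong (c +_) (sym (∣⊥∣≡0 n)))
  ∣⊤∣≡n+∣⊥∣ : ∣ ⊤ {n} ∣ ≡ n + ∣ ⊥ {n} ∣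
  ∣⊤∣≡n+∣⊥∣ = trans (∣⊤∣≡n n) (trans (sym (+-identityʳ n)) (cong (n +_) (sym (∣⊥∣≡0 n))))

size≡# : ∀ {n k} (𝓕 : Family n k) {Q? : Decidable (_∈ᶠ 𝓕)} → size 𝓕 ≡ # Q?
size≡# {n} 𝓕 {Q?} = ≤-antisym
  (length≤count _≟ˢ_ Q? (Family.unique 𝓕) ∈-subsets (All.tabulate id))
  (count≤length _≟ˢ_ Q? (Family.members 𝓕) (subsets-unique n) (λ _ → id))

-- Otherwise `S < suc n * f v` for every `v`, and summing over the `suc n` vertices contradicts the
-- bound on the sum.
average : ∀ n (f : Fin (suc n) → ℕ) S → Σ[ allFin (suc n) ] f ≤ S → ∃[ v ] (suc n * f v ≤ S)
average n f S Σ≤S with Fin.any? (λ v → suc n * f v ≤? S)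
... | yes w = w
... | no ¬w = contradiction (*-cancelˡ-≤ (suc n) total) (<⇒≱ (s≤s Σ≤S))
  where
  open ≤-Reasoning
  total : suc n * suc S ≤ suc n * Σ[ allFin (suc n) ] f
  total = begin
    suc n * suc S                                  ≡⟨ cong (_* suc S) (sym (List.length-tabulate {n = suc n} id)) ⟩
    length (allFin (suc n)) * suc S                ≡⟨ sym (Σ-const (allFin (suc n)) (suc S)) ⟩
    Σ[ allFin (suc n) ] (λ _ → suc S)              ≤⟨ Σ-mono (allFin (suc n)) (λ v → ≰⇒> (λ le → ¬w (v , le))) ⟩
    Σ[ allFin (suc n) ] (λ v → suc n * f v)        ≡⟨ Σ-* (allFin (suc n)) (suc n) f ⟩
    suc n * Σ[ allFin (suc n) ] f                  ∎

-- The bound of `length-codes` for a set of size `1 + j`.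
badness : ℕ → ℕ
badness j = 2 ^ (1 + j) * ((3 + j) * ((3 + j) + (3 + j)))

-- Twice the sum of `1 + k`, the error allowed in the size of the family, and the contribution of
-- bad members, both in units of C(N, k-2) for a ground set of size N.
deficiency : ℕ → ℕ
deficiency j = 2 * (4 + j + badness j)

module Stability (n j : ℕ) (𝓕 : Family (suc n) (3 + j)) (free : ClusterFree 3 𝓕) where

  open Structure (suc n) j 𝓕 free

  a : ℕ
  a = binom (suc n) (1 + j)

  facets : ℕ
  facets = binom (suc n) (2 + j)

  Centered : Subset (suc n) → Set
  Centered F = ∃[ x ] (x ∈ F × Center F x)

  centered? : Decidable Centered
  centered? F = Fin.any? (λ x → (x ∈? F) ×-dec center? F x)

  own? : ∀ F r → Dec (Own F r)
  own? F r = (r ∈? F) ×-dec flexible? ⁅ r ⁆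

  inBad? : Decidable (λ F → F ∈ᶠ 𝓕 × Bad F)
  inBad? F = (F ∈ᶠ? 𝓕) ×-dec bad? F

  inGood? : Decidable (λ F → F ∈ᶠ 𝓕 × ¬ Bad F)
  inGood? F = (F ∈ᶠ? 𝓕) ×-dec ¬? (bad? F)

  inCentered? : Decidable (λ F → F ∈ᶠ 𝓕 × Centered F)
  inCentered? F = (F ∈ᶠ? 𝓕) ×-dec centered? F

  inOther? : Decidable (λ F → F ∈ᶠ 𝓕 × ¬ Bad F × ¬ Centered F)
  inOther? F = (F ∈ᶠ? 𝓕) ×-dec ¬? (bad? F) ×-dec ¬? (centered? F)

  #bad : # inBad? ≤ badness j * a
  #bad = ≤-trans
    (count-relation (subsets (suc n)) (subsets (suc n)) inBad?
      (λ F Q → (∣ Q ∣ ≟ 1 + j) ×-dec (F ∈ˡ? codes Q)) (λ Q → ∣ Q ∣ ≟ 1 + j) {badness j}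
      (λ { F (_ , Q , w) → #-one (λ Q → (∣ Q ∣ ≟ 1 + j) ×-dec (F ∈ˡ? codes Q)) Q w })
      (λ Q ∣Q∣ → ≤-trans
        (count≤length _≟ˢ_ (λ F → (∣ Q ∣ ≟ 1 + j) ×-dec (F ∈ˡ? codes Q)) (codes Q) (subsets-unique _) (λ _ → proj₂))
        (≤-trans (length-codes Q) (≤-reflexive (cong (λ s → 2 ^ s * (k * (k + k))) ∣Q∣))))
      (λ _ _ → proj₁))
    (≤-reflexive (cong (badness j *_) (#size (suc n) (1 + j))))

  facet-size : ∀ {F x} → F ∈ᶠ 𝓕 → x ∈ F → ∣ F - x ∣ ≡ 2 + j
  facet-size {F} F∈ x∈F = suc-injective (trans (∣p-x∣ {p = F} x∈F) (∣∣≡k F∈))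

  facet-injective : ∀ {F : Subset (suc n)} {p q} → p ∈ F → p ≢ q → F - p ≢ F - q
  facet-injective {F} {p} p∈F p≢q eq = x∉p-x {p = F} (subst (p ∈_) (sym eq) (x∈p∧x≢y⇒x∈p-y p∈F p≢q))

  OwnFacet : Subset (suc n) → Subset (suc n) → Set
  OwnFacet F P = F ∈ᶠ 𝓕 × ∃[ r ] (Own F r × P ≡ F - r)

  ownFacet? : ∀ F P → Dec (OwnFacet F P)
  ownFacet? F P = (F ∈ᶠ? 𝓕) ×-dec Fin.any? (λ r → own? F r ×-dec (P ≟ˢ F - r))

  -- Every good member has an own facet, and one without a center has two, which pays for counting
  -- it twice. No facet is own for two members.
  good+other≤facets : # inGood? + # inOther? ≤ facets
  good+other≤facets = begin
    # inGood? + # inOther?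
      ≡⟨ sym (Σ-+ (subsets (suc n)) _ _) ⟩
    Σ[ subsets (suc n) ] (λ F → ind (inGood? F) + ind (inOther? F))
      ≤⟨ Σ-bounded-degree (subsets (suc n)) (subsets (suc n)) ownFacet? (λ P → ∣ P ∣ ≟ 2 + j) {b = 1} lower
           (λ P _ → #-unique (λ F → ownFacet? F P) λ { (F∈ , r , own , eq) (F′∈ , r′ , own′ , eq′) →
             own-facet-unique F∈ F′∈ own (proj₁ own′) (trans (sym eq) eq′) })
           (λ { F P (F∈ , r , own , refl) → facet-size F∈ (proj₁ own) }) ⟩
    1 * # {suc n} (λ P → ∣ P ∣ ≟ 2 + j)
      ≡⟨ trans (*-identityˡ _) (#size (suc n) (2 + j)) ⟩
    facets ∎
    where
    open ≤-Reasoning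
    two : ∀ {F} → F ∈ᶠ 𝓕 → TwoOwn F → 2 ≤ # (ownFacet? F)
    two {F} F∈ (p , q , p≢q , p-own , q-own) =
      length≤count _≟ˢ_ (ownFacet? F) {ys = (F - p) ∷ (F - q) ∷ []}
        ((facet-injective {F} (proj₁ p-own) p≢q ∷ []) ∷ [] ∷ []) ∈-subsets
        ((F∈ , p , p-own , refl) ∷ (F∈ , q , q-own , refl) ∷ [])
    lower : ∀ F → ind (inGood? F) + ind (inOther? F) ≤ # (ownFacet? F)
    lower F = by-cases (inGood? F) (inOther? F)
      where
      by-cases : (d : Dec (F ∈ᶠ 𝓕 × ¬ Bad F)) (e : Dec (F ∈ᶠ 𝓕 × ¬ Bad F × ¬ Centered F)) →
        ind d + ind e ≤ # (ownFacet? F)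
      by-cases (no ¬g) (no _) = z≤n
      by-cases (no ¬g) (yes (F∈ , good , _)) = contradiction (F∈ , good) ¬g
      by-cases (yes (F∈ , good)) e = Sum.[ centered , (λ 2own → ≤-trans (s≤s (ind≤1 e)) (two F∈ 2own)) ]′
        (good-dichotomy F∈ good)
        where
        centered : Centered F → suc (ind e) ≤ # (ownFacet? F)
        centered (x , x∈F , c) = ≤-trans
          (≤-reflexive (cong suc (ind-no e (λ { (_ , _ , ¬c) → ¬c (x , x∈F , c) }))))
          (#-one (ownFacet? F) (F - x) (F∈ , x , (x∈F , center-flexible c (x∈⁅x⁆ x) (⁅x⁆⊆ x∈F)) , refl))

  -- Labels of the (k-1)-sets

  Label : Subset (suc n) → Fin (suc n) → Set
  Label P x = x ∉ P × P ⊕ x ∈ᶠ 𝓕 × Center (P ⊕ x) x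

  label? : ∀ P x → Dec (Label P x)
  label? P x = ¬? (x ∈? P) ×-dec ((P ⊕ x) ∈ᶠ? 𝓕) ×-dec center? (P ⊕ x) x

  Labelled : Subset (suc n) → Set
  Labelled P = ∃ (Label P)

  labelled? : Decidable Labelled
  labelled? P = Fin.any? (label? P)

  Unlabelled : Subset (suc n) → Set
  Unlabelled P = ∣ P ∣ ≡ 2 + j × ¬ Labelled P

  unlabelled? : Decidable Unlabelled
  unlabelled? P = (∣ P ∣ ≟ 2 + j) ×-dec ¬? (labelled? P)

  label-size : ∀ {P x} → Label P x → ∣ P ∣ ≡ 2 + j
  label-size {P} {x} (x∉P , F∈ , _) = suc-injective (trans (sym (∣p⊕x∣ {p = P} x∉P)) (∣∣≡k F∈))

  labels-agree : ∀ {P P′ x x′ u} → Label P x → Label P′ x′ → u ∈ P → u ∈ P′ → x ≡ x′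
  labels-agree {P} {P′} (x∉P , F∈ , c) (x′∉P′ , F′∈ , c′) u∈P u∈P′ =
    centers-agree F∈ F′∈ (x∈p⊕x {p = P}) (x∈p⊕x {p = P′}) c c′ (p⊆p⊕x u∈P) (p⊆p⊕x u∈P′)
      (λ { refl → x∉P u∈P }) (λ { refl → x′∉P′ u∈P′ })

  CenterFacet : Subset (suc n) → Subset (suc n) → Set
  CenterFacet F P = F ∈ᶠ 𝓕 × ∃[ x ] ((x ∈ F × Center F x) × P ≡ F - x)

  centerFacet? : ∀ F P → Dec (CenterFacet F P)
  centerFacet? F P = (F ∈ᶠ? 𝓕) ×-dec Fin.any? (λ x → ((x ∈? F) ×-dec center? F x) ×-dec (P ≟ˢ F - x))

  -- Removing a center `x` from `F` leaves a set labelled `x`. A center is flexible as a singleton,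
  -- so `own-facet-unique` makes this injective.
  centered≤labelled : # inCentered? ≤ # labelled?
  centered≤labelled = ≤-trans
    (count-relation (subsets (suc n)) (subsets (suc n)) inCentered? centerFacet? labelled? {1}
      (λ { F (F∈ , x , x∈F , c) → #-one (centerFacet? F) (F - x) (F∈ , x , (x∈F , c) , refl) })
      (λ P _ → #-unique (λ F → centerFacet? F P)
        λ { (F∈ , x , (x∈F , c) , eq) (F′∈ , x′ , (x′∈F′ , _) , eq′) →
          own-facet-unique F∈ F′∈ (x∈F , center-flexible c (x∈⁅x⁆ x) (⁅x⁆⊆ x∈F)) x′∈F′ (trans (sym eq) eq′) })
      (λ { F P (F∈ , x , (x∈F , c) , refl) → x , x∉p-x {p = F} ,
        subst (_∈ᶠ 𝓕) (sym (p-x⊕x≡p {p = F} x∈F)) F∈ , subst (λ F → Center F x) (sym (p-x⊕x≡p {p = F} x∈F)) c }))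
    (≤-reflexive (*-identityˡ _))

  labelled+unlabelled≤facets : # labelled? + # unlabelled? ≤ facets
  labelled+unlabelled≤facets = ≤-trans
    (count-disjoint labelled? unlabelled? (λ P → ∣ P ∣ ≟ 2 + j) (subsets (suc n))
      (λ P (x , l) → label-size l) (λ P → proj₁) (λ P l (_ , ¬l) → ¬l l))
    (≤-reflexive (#size (suc n) (2 + j)))

  -- The size of the family is compared with the number of all (k-1)-sets, up to an error of order
  -- n^(k-2).
  module _ (large : facets ≤ size 𝓕 + (1 + k) * a) where

    #unlabelled : # unlabelled? ≤ deficiency j * a
    #unlabelled = combine (# unlabelled?) (# labelled?) (# inGood?) (# inOther?) (# inBad?)
      labelled+unlabelled≤facets good+other≤facets
      (≤-trans (count-split inGood? inCentered? inOther? (subsets (suc n)) split)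
        (+-monoˡ-≤ (# inOther?) centered≤labelled))
      (≤-trans (≤-reflexive (size≡# 𝓕 {_∈ᶠ? 𝓕}))
        (count-split (_∈ᶠ? 𝓕) inBad? inGood? (subsets (suc n)) bad-or-good))
      #bad
      where
      split : ∀ F → F ∈ᶠ 𝓕 × ¬ Bad F → (F ∈ᶠ 𝓕 × Centered F) ⊎ (F ∈ᶠ 𝓕 × ¬ Bad F × ¬ Centered F)
      split F (F∈ , good) = Sum.map (F∈ ,_) (λ ¬c → F∈ , good , ¬c) (toSum (centered? F))
      bad-or-good : ∀ F → F ∈ᶠ 𝓕 → (F ∈ᶠ 𝓕 × Bad F) ⊎ (F ∈ᶠ 𝓕 × ¬ Bad F)
      bad-or-good F F∈ = Sum.map (F∈ ,_) (F∈ ,_) (toSum (bad? F))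
      -- With `T` for the size of the family and `A` for the allowed error: u ≤ facets - l ≤ facets
      -- - g + o ≤ 2 (facets - g) ≤ 2 (A + b). Adding the inequalities and cancelling avoids
      -- subtraction.
      combine : ∀ u l g o b → l + u ≤ facets → g + o ≤ facets → g ≤ l + o → size 𝓕 ≤ b + g →
        b ≤ badness j * a → u ≤ deficiency j * a
      combine u l g o b lu go glo Tbg b≤ = begin
        u                                        ≤⟨ +-cancelʳ-≤ (l + o + g + g + (T + T) + (facets + facets)) u (b + b + (A + A)) key ⟩
        b + b + (A + A)                          ≤⟨ +-monoˡ-≤ (A + A) (+-mono-≤ b≤ b≤) ⟩
        K * a + K * a + (A + A)                  ≡⟨ collect j K a ⟩
        deficiency j * a                         ∎
        where
        open ≤-Reasoning
        T K A : ℕ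
        T = size 𝓕
        K = badness j
        A = (1 + k) * a
        collect : ∀ j K a → K * a + K * a + ((4 + j) * a + (4 + j) * a) ≡ 2 * (4 + j + K) * a
        collect = solve-∀
        left : ∀ u l g o T C → u + (l + o + g + g + (T + T) + (C + C)) ≡ l + u + (g + o) + g + (T + T) + (C + C)
        left = solve-∀
        right : ∀ C l o b g T A → C + C + (l + o) + (b + g + (b + g)) + (T + A + (T + A)) ≡
          b + b + (A + A) + (l + o + g + g + (T + T) + (C + C))
        right = solve-∀
        key : u + (l + o + g + g + (T + T) + (facets + facets)) ≤ b + b + (A + A) + (l + o + g + g + (T + T) + (facets + facets))
        key = begin
          u + (l + o + g + g + (T + T) + (facets + facets))
            ≡⟨ left u l g o T facets ⟩
          l + u + (g + o) + g + (T + T) + (facets + facets)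
            ≤⟨ +-mono-≤ (+-mono-≤ (+-mono-≤ (+-mono-≤ lu go) glo) (+-mono-≤ Tbg Tbg)) (+-mono-≤ large large) ⟩
          facets + facets + (l + o) + (b + g + (b + g)) + (T + A + (T + A))
            ≡⟨ right facets l o b g T A ⟩
          b + b + (A + A) + (l + o + g + g + (T + T) + (facets + facets)) ∎

    unlabelled-at? : ∀ v → Decidable (λ P → Unlabelled P × v ∈ P)
    unlabelled-at? v P = unlabelled? P ×-dec (v ∈? P)

    Σ-unlabelled-at : Σ[ allFin (suc n) ] (λ v → # (unlabelled-at? v)) ≤ (2 + j) * # unlabelled?
    Σ-unlabelled-at = Σ-bounded-degree (allFin (suc n)) (subsets (suc n)) unlabelled-at? unlabelled?
      (λ v → ≤-refl)
      (λ P (∣P∣ , _) → ≤-trans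
        (count-mono (λ v → unlabelled-at? v P) (_∈? P) (allFin (suc n)) (λ _ → proj₂))
        (≤-reflexive (trans (∣∣≡count P) ∣P∣)))
      (λ _ _ → proj₁)

    -- Otherwise all C(n, k-2) of the (k-1)-sets through `v` would be unlabelled, more than the
    -- average allows.
    labelled-at : ∀ v → suc n * # (unlabelled-at? v) ≤ (2 + j) * # unlabelled? →
      (2 + j) * deficiency j * 2 ≤ n → a ≤ 2 * binom n (1 + j) → 1 ≤ binom n (1 + j) →
      ∃[ P ] (Labelled P × v ∈ P)
    labelled-at v few K≤n a≤2b 1≤b = decidable-stable (anySubset? (λ P → labelled? P ×-dec (v ∈? P)))
      (λ ¬w → contradiction (through ¬w) (<⇒≱ (*-monoˡ-< b {{>-nonZero 1≤b}} (s≤s K≤n))))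
      where
      open ≤-Reasoning
      b : ℕ
      b = binom n (1 + j)
      reassoc : ∀ p d b → p * (d * (2 * b)) ≡ p * d * 2 * b
      reassoc = solve-∀
      1+j+1 : 1 + j + ∣ ⁅ v ⁆ ∣ ≡ 2 + j
      1+j+1 = trans (cong (1 + j +_) (∣⁅x⁆∣≡1 v)) (+-comm (1 + j) 1)
      all-unlabelled : ¬ (∃[ P ] (Labelled P × v ∈ P)) → b ≤ # (unlabelled-at? v)
      all-unlabelled ¬w = ≤-trans
        (≤-reflexive (sym (#between ⁅ v ⁆ ⊤ n (1 + j) ⊆⊤
          (trans (∣⊤∣≡n (suc n)) (trans (+-comm 1 n) (cong (n +_) (sym (∣⁅x⁆∣≡1 v))))))))
        (count-mono (between? ⁅ v ⁆ ⊤ (1 + j)) (unlabelled-at? v) (subsets (suc n))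
          (λ { P (v⊆P , _ , ∣P∣) → (trans ∣P∣ 1+j+1 , λ l → ¬w (P , l , v⊆P (x∈⁅x⁆ v))) , v⊆P (x∈⁅x⁆ v) }))
      through : ¬ (∃[ P ] (Labelled P × v ∈ P)) → suc n * b ≤ (2 + j) * deficiency j * 2 * b
      through ¬w = begin
        suc n * b                                ≤⟨ *-monoʳ-≤ (suc n) (all-unlabelled ¬w) ⟩
        suc n * # (unlabelled-at? v)             ≤⟨ few ⟩
        (2 + j) * # unlabelled?                  ≤⟨ *-monoʳ-≤ (2 + j) #unlabelled ⟩
        (2 + j) * (deficiency j * a)             ≤⟨ *-monoʳ-≤ (2 + j) (*-monoʳ-≤ (deficiency j) a≤2b) ⟩
        (2 + j) * (deficiency j * (2 * b))       ≡⟨ reassoc (2 + j) (deficiency j) b ⟩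
        (2 + j) * deficiency j * 2 * b           ∎

    notLabel? : ∀ x → Decidable (λ P → ∣ P ∣ ≡ 2 + j × ¬ Label P x)
    notLabel? x P = (∣ P ∣ ≟ 2 + j) ×-dec ¬? (label? P x)

    otherLabel? : ∀ x → Decidable (λ P → Labelled P × ¬ Label P x)
    otherLabel? x P = labelled? P ×-dec ¬? (label? P x)

    -- Listing the exchanges of `v` for a vertex `w` shows that one `P′` serves at most `suc n` sets
    -- `P`.
    Swap : Fin (suc n) → Subset (suc n) → Subset (suc n) → Set
    Swap v P P′ = (Unlabelled P′ × v ∈ P′) × P ∈ˡ map (λ w → P′ - v ⊕ w) (allFin (suc n))

    swap? : ∀ v P P′ → Dec (Swap v P P′)
    swap? v P P′ = unlabelled-at? v P′ ×-dec (P ∈ˡ? map (λ w → P′ - v ⊕ w) (allFin (suc n)))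

    -- If P₀ ∋ v has label x and P has another label, then v ∉ P, and P - w ⊕ v meets both
    -- P₀ and P for each w ∈ P, so it cannot have a label.
    #otherLabel : ∀ {P₀ v x} → Label P₀ x → v ∈ P₀ → # (otherLabel? x) ≤ suc n * # (unlabelled-at? v)
    #otherLabel {P₀} {v} {x} l₀ v∈P₀ = count-relation (subsets (suc n)) (subsets (suc n))
      (otherLabel? x) (swap? v) (unlabelled-at? v)
      (λ { P ((y , l) , ¬lx) → lower P y l ¬lx })
      (λ P′ _ → ≤-trans
        (count≤length _≟ˢ_ (λ P → swap? v P P′) (map (λ w → P′ - v ⊕ w) (allFin (suc n))) (subsets-unique _) (λ _ → proj₂))
        (≤-reflexive (trans (List.length-map _ (allFin (suc n))) (List.length-tabulate {n = suc n} id))))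
      (λ _ _ → proj₁)
      where
      swapped : ∀ P y {w u} → Label P y → ¬ Label P x → w ∈ P → u ∈ P → u ≢ w → Swap v P (P - w ⊕ v)
      swapped P y {w} {u} l ¬lx w∈P u∈P u≢w = ((∣P′∣ , ¬labelled) , x∈p⊕x {p = P - w}) , P∈
        where
        P′ : Subset (suc n)
        P′ = P - w ⊕ v
        x≢y : x ≢ y
        x≢y refl = ¬lx l
        v∉P : v ∉ P
        v∉P v∈P = x≢y (labels-agree l₀ l v∈P₀ v∈P)
        v∉P-w : v ∉ P - w
        v∉P-w v∈ = v∉P (proj₁ (x∈p-y⁻ v∈))
        ∣P′∣ : ∣ P′ ∣ ≡ 2 + j
        ∣P′∣ = trans (∣p⊕x∣ {p = P - w} v∉P-w) (trans (∣p-x∣ {p = P} w∈P) (label-size l))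
        ¬labelled : ¬ Labelled P′
        ¬labelled (z , l′) = x≢y (trans
          (labels-agree l₀ l′ v∈P₀ (x∈p⊕x {p = P - w}))
          (labels-agree {u = u} l′ l (p⊆p⊕x (x∈p∧x≢y⇒x∈p-y u∈P u≢w)) u∈P))
        P∈ : P ∈ˡ map (λ w → P′ - v ⊕ w) (allFin (suc n))
        P∈ = subst (_∈ˡ map (λ w → P′ - v ⊕ w) (allFin (suc n)))
          (trans (cong (_⊕ w) (p⊕x-x≡p {p = P - w} v∉P-w)) (p-x⊕x≡p {p = P} w∈P))
          (∈-map⁺ (λ w → P′ - v ⊕ w) (∈-allFin w))
      lower : ∀ P y → Label P y → ¬ Label P x → 1 ≤ # (swap? v P)
      lower P y l ¬lx =
        let w , w∈P       = ∣p∣≥1⇒nonempty {p = P} (≤-trans (s≤s z≤n) (≤-reflexive (sym (label-size l))))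
            -- The vertex `u` survives the exchange, so the new set still meets `P`.
            u , u∈P , u≢w = other-element {P} (≤-trans (s≤s (s≤s z≤n)) (≤-reflexive (sym (label-size l)))) w
        in #-one (swap? v P) (P - w ⊕ v) (swapped P y l ¬lx w∈P u∈P u≢w)

    -- Removing `x` is injective on sets through `x`, and a label `x` on `G - x` would put `G` into
    -- the family.
    #missing≤#notLabel : ∀ x → # (missing? x) ≤ # (notLabel? x)
    #missing≤#notLabel x = ≤-trans
      (count-relation (subsets (suc n)) (subsets (suc n)) (missing? x)
        (λ G P → missing? x G ×-dec (P ≟ˢ G - x)) (notLabel? x) {1}
        (λ G m → #-one (λ P → missing? x G ×-dec (P ≟ˢ G - x)) (G - x) (m , refl))
        (λ P _ → #-unique (λ G → missing? x G ×-dec (P ≟ˢ G - x))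
          λ { {G} {G′} ((_ , x∈G , _) , eq) ((_ , x∈G′ , _) , eq′) →
            trans (sym (p-x⊕x≡p {p = G} x∈G)) (trans (cong (_⊕ x) (trans (sym eq) eq′)) (p-x⊕x≡p {p = G′} x∈G′)) })
        (λ { G P ((∣G∣ , x∈G , G∉) , refl) → suc-injective (trans (∣p-x∣ {p = G} x∈G) ∣G∣) ,
          λ (_ , F∈ , _) → G∉ (subst (_∈ᶠ 𝓕) (p-x⊕x≡p {p = G} x∈G) F∈) }))
      (≤-reflexive (*-identityˡ _))

    -- The vertex `v` has at most the average number of unlabelled sets, and `x` is the label of
    -- some set through `v`. Few sets through `v` being unlabelled leaves few sets with another
    -- label.
    frequent-label : (2 + j) * deficiency j * 2 ≤ n → a ≤ 2 * binom n (1 + j) → 1 ≤ binom n (1 + j) →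
      ∃[ x ] (# (missing? x) ≤ k * deficiency j * a)
    frequent-label K≤n a≤2b 1≤b =
      let v , few = average n (λ v → # (unlabelled-at? v)) ((2 + j) * # unlabelled?) Σ-unlabelled-at
          P₀ , (x , l₀) , v∈P₀ = labelled-at v few K≤n a≤2b 1≤b
      in x , bound v few l₀ v∈P₀
      where
      open ≤-Reasoning
      split : ∀ x P → ∣ P ∣ ≡ 2 + j × ¬ Label P x → Unlabelled P ⊎ (Labelled P × ¬ Label P x)
      split x P (∣P∣ , ¬l) = Sum.map (∣P∣ ,_) (_, ¬l) (Sum.swap (toSum (labelled? P)))
      bound : ∀ v → suc n * # (unlabelled-at? v) ≤ (2 + j) * # unlabelled? → ∀ {P₀ x} → Label P₀ x → v ∈ P₀ →
        # (missing? x) ≤ k * deficiency j * a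
      bound v few {P₀} {x} l₀ v∈P₀ = begin
        # (missing? x)                                         ≤⟨ #missing≤#notLabel x ⟩
        # (notLabel? x)                                        ≤⟨ count-split (notLabel? x) unlabelled? (otherLabel? x)
                                                                    (subsets (suc n)) (split x) ⟩
        # unlabelled? + # (otherLabel? x)                      ≤⟨ +-monoʳ-≤ (# unlabelled?) (≤-trans (#otherLabel l₀ v∈P₀) few) ⟩
        -- The factor `k` is one for the unlabelled sets plus `2 + j` for those with another label.
        k * # unlabelled?                                      ≤⟨ *-monoʳ-≤ k #unlabelled ⟩
        k * (deficiency j * a)                                 ≡⟨ sym (*-assoc k (deficiency j) a) ⟩
        k * deficiency j * a                                   ∎

-- Members avoiding the frequent label

-- Linear growth in `e`: each step adds a positive summand of Pascal's rule.
binom-lower : ∀ e s → 1 ≤ s → suc e ≤ binom (e + s) s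
binom-lower zero    (suc zero)    _ = ≤-refl
binom-lower zero    (suc (suc s)) _ = ≤-trans (binom-lower zero (suc s) (s≤s z≤n)) (m≤m+n _ _)
binom-lower (suc e) (suc s)       _ = begin
  suc (suc e)                                              ≤⟨ +-mono-≤ (binom-pos (suc e) s) (binom-lower e (suc s) (s≤s z≤n)) ⟩
  binom (suc e + s) s + binom (e + suc s) (suc s)          ≡⟨ cong (λ t → binom t s + binom (e + suc s) (suc s)) (sym (+-suc e s)) ⟩
  binom (e + suc s) s + binom (e + suc s) (suc s)          ∎
  where
  open ≤-Reasoning
  binom-pos : ∀ e s → 1 ≤ binom (e + s) s
  binom-pos e       zero    = ≤-refl
  binom-pos zero    (suc s) = ≤-trans (binom-pos zero s) (m≤m+n _ _)
  binom-pos (suc e) (suc s) = ≤-trans (binom-pos e (suc s)) (m≤n+m _ (binom (e + suc s) s))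

∣p∩q∣+∣p─q∣ : ∀ {n} (p q : Subset n) → ∣ p ∩ q ∣ + ∣ p ─ q ∣ ≡ ∣ p ∣
∣p∩q∣+∣p─q∣ [] [] = refl
∣p∩q∣+∣p─q∣ (outside ∷ p) (outside ∷ q) = ∣p∩q∣+∣p─q∣ p q
∣p∩q∣+∣p─q∣ (outside ∷ p) (inside ∷ q)  = ∣p∩q∣+∣p─q∣ p q
∣p∩q∣+∣p─q∣ (inside ∷ p) (outside ∷ q)  = trans (+-suc _ _) (cong suc (∣p∩q∣+∣p─q∣ p q))
∣p∩q∣+∣p─q∣ (inside ∷ p) (inside ∷ q)   = cong suc (∣p∩q∣+∣p─q∣ p q)

x∈⋃⁺ : ∀ {n} {x : Fin n} {p} ps → p ∈ˡ ps → x ∈ p → x ∈ ⋃ ps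
x∈⋃⁺ (p ∷ ps) (here refl) x∈p = x∈p∪q⁺ (inj₁ x∈p)
x∈⋃⁺ (p ∷ ps) (there p∈)  x∈p = x∈p∪q⁺ (inj₂ (x∈⋃⁺ ps p∈ x∈p))

x∈⋃⁻ : ∀ {n} {x : Fin n} ps → x ∈ ⋃ ps → ∃[ p ] (p ∈ˡ ps × x ∈ p)
x∈⋃⁻ [] x∈ = contradiction x∈ ∉⊥
x∈⋃⁻ (p ∷ ps) x∈ with x∈p∪q⁻ p (⋃ ps) x∈
... | inj₁ x∈p = p , here refl , x∈p
... | inj₂ x∈⋃ with x∈⋃⁻ ps x∈⋃
...   | q , q∈ , x∈q = q , there q∈ , x∈q

-- The excess `e` is n - 2k, so the complement of a k-set has `e + k` vertices.
module Endgame (n j e : ℕ) (n≡ : n ≡ 3 + j + (e + (3 + j)))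
  (𝓕 : Family n (3 + j)) (free : ClusterFree 3 𝓕) (x : Fin n) where

  open Structure n j 𝓕 free

  -- These are C(n-k-1, k-1), the size of a star in the complement of a k-set, and C(n-k-2, k-2),
  -- the number of its sets through a second vertex.
  m b : ℕ
  m = binom (e + (2 + j)) (2 + j)
  b = binom (e + (1 + j)) (1 + j)

  Outside : Subset n → Set
  Outside F = F ∈ᶠ 𝓕 × x ∉ F

  outside? : Decidable Outside
  outside? F = (F ∈ᶠ? 𝓕) ×-dec ¬? (x ∈? F)

  meets? : ∀ B → Decidable (λ F → F ∈ᶠ 𝓕 × x ∈ F × Nonempty (F ∩ B))
  meets? B F = (F ∈ᶠ? 𝓕) ×-dec (x ∈? F) ×-dec nonempty? (F ∩ B)

  avoids? : ∀ B → Decidable (λ F → F ∈ᶠ 𝓕 × x ∈ F × Empty (F ∩ B))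
  avoids? B F = (F ∈ᶠ? 𝓕) ×-dec (x ∈? F) ×-dec ¬? (nonempty? (F ∩ B))

  away? : ∀ B → Decidable (λ G → Missing x G × Empty (G ∩ B))
  away? B G = missing? x G ×-dec ¬? (nonempty? (G ∩ B))

  ⊆∁⇒Empty∩ : ∀ {G B : Subset n} → G ⊆ ∁ B → Empty (G ∩ B)
  ⊆∁⇒Empty∩ {G} {B} G⊆∁B (v , v∈) = let v∈G , v∈B = x∈p∩q⁻ G B v∈ in x∈∁p⇒x∉p (G⊆∁B v∈G) v∈B

  Empty∩⇒⊆∁ : ∀ {G B : Subset n} → Empty (G ∩ B) → G ⊆ ∁ B
  Empty∩⇒⊆∁ em v∈G = x∉p⇒x∈∁p (λ v∈B → em (_ , x∈p∩q⁺ (v∈G , v∈B)))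

  ∣∁∣ : ∀ B → ∣ B ∣ ≡ k → ∣ ∁ B ∣ ≡ e + k
  ∣∁∣ B ∣B∣ = trans (∣∁p∣≡n∸∣p∣ B) (trans (cong₂ _∸_ n≡ ∣B∣) (m+n∸m≡n k (e + k)))

  #away≤#missing : ∀ B → # (away? B) ≤ # (missing? x)
  #away≤#missing B = count-mono (away? B) (missing? x) (subsets n) (λ _ → proj₁)

  ∣⁅x⁆⊕w∣ : ∀ {w} → w ≢ x → ∣ ⁅ x ⁆ ⊕ w ∣ ≡ 2
  ∣⁅x⁆⊕w∣ w≢x = trans (∣p⊕x∣ {p = ⁅ x ⁆} (x≢y⇒x∉⁅y⁆ w≢x)) (cong suc (∣⁅x⁆∣≡1 x))

  module Member {B} (B∈ : B ∈ᶠ 𝓕) (x∉B : x ∉ B) where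

    -- Here F ⊆ G ∪ B and G ∩ B = ∅, so F, G and B would form a cluster.
    meets-kills : ∀ {F G} → F ∈ᶠ 𝓕 → x ∈ F → Nonempty (F ∩ B) → F ─ B ⊆ G → G ⊆ ∁ B → ¬ (G ∈ᶠ 𝓕)
    meets-kills {F} {G} F∈ x∈F (v , v∈) F─B⊆G G⊆∁B G∈ =
      no-cluster F∈ G∈ B∈ (≢-witness (proj₁ (x∈p∩q⁻ F B v∈)) (λ v∈G → G∩B v∈G (proj₂ (x∈p∩q⁻ F B v∈))))
        (≢-witness x∈F x∉B) (≢-witness (F─B⊆G (x∈p∧x∉q⇒x∈p─q x∈F x∉B)) x∉B) cover (λ _ → G∩B)
      where
      G∩B : ∀ {v} → v ∈ G → v ∉ B
      G∩B v∈G = x∈∁p⇒x∉p (G⊆∁B v∈G)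
      cover : ∀ {v} → v ∈ F → v ∈ G ⊎ v ∈ B
      cover {v} v∈F = Sum.swap (Sum.map₂ (λ v∉B → F─B⊆G (x∈p∧x∉q⇒x∈p─q v∈F v∉B)) (toSum (v ∈? B)))

    Kills : Subset n → Subset n → Set
    Kills F G = (F ∈ᶠ 𝓕 × x ∈ F × Nonempty (F ∩ B)) × (Missing x G × Empty (G ∩ B)) × F ─ B ⊆ G

    kills? : ∀ F G → Dec (Kills F G)
    kills? F G = meets? B F ×-dec away? B G ×-dec (F ─ B ⊆? G)

    -- The sets killed by `F` extend `F ─ B` within the complement of `B` by `s = ∣ F ∩ B ∣ ≥ 1` of
    -- `e + s` vertices, so there are more than `e`. Conversely `F ⊆ G ∪ B` leaves at most
    -- `2 ^ (k + k)` choices of `F` for each `G`.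
    e*#meets≤#away : e * # (meets? B) ≤ 2 ^ (k + k) * # (away? B)
    e*#meets≤#away = ≤-trans
      (double-count (subsets n) (subsets n) (meets? B) kills? (away? B) {e} {2 ^ (k + k)} {1}
        (λ F meets → ≤-trans (lower F meets) (≤-reflexive (sym (*-identityˡ _)))) upper (λ _ _ → proj₁ ∘ proj₂))
      (≤-reflexive (*-identityˡ _))
      where
      lower : ∀ F → F ∈ᶠ 𝓕 × x ∈ F × Nonempty (F ∩ B) → e ≤ # (kills? F)
      lower F meets@(F∈ , x∈F , ne@(v , v∈)) = begin
        e                                      ≤⟨ n≤1+n e ⟩
        suc e                                  ≤⟨ binom-lower e s 1≤s ⟩
        binom (e + s) s                        ≡⟨ sym (#between (F ─ B) (∁ B) (e + s) s ─⊆∁ ∣∁B∣) ⟩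
        # (between? (F ─ B) (∁ B) s)           ≤⟨ count-mono (between? (F ─ B) (∁ B) s) (kills? F) (subsets n) to-kills ⟩
        # (kills? F)                           ∎
        where
        open ≤-Reasoning
        s : ℕ
        s = ∣ F ∩ B ∣
        s+t : s + ∣ F ─ B ∣ ≡ k
        s+t = trans (∣p∩q∣+∣p─q∣ F B) (∣∣≡k F∈)
        1≤s : 1 ≤ s
        1≤s = ≤-trans (≤-reflexive (sym (∣⁅x⁆∣≡1 v))) (p⊆q⇒∣p∣≤∣q∣ (⁅x⁆⊆ v∈))
        ─⊆∁ : F ─ B ⊆ ∁ B
        ─⊆∁ v∈ = x∉p⇒x∈∁p (proj₂ (x∈p─q⁻ {n} F B v∈))
        ∣∁B∣ : ∣ ∁ B ∣ ≡ e + s + ∣ F ─ B ∣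
        ∣∁B∣ = trans (∣∁∣ B (∣∣≡k B∈)) (trans (cong (e +_) (sym s+t)) (sym (+-assoc e s _)))
        to-kills : ∀ G → Between (F ─ B) (∁ B) s G → Kills F G
        to-kills G (F─B⊆G , G⊆∁B , ∣G∣) = meets ,
          ((trans ∣G∣ s+t , F─B⊆G (x∈p∧x∉q⇒x∈p─q x∈F x∉B) , meets-kills F∈ x∈F ne F─B⊆G G⊆∁B) , ⊆∁⇒Empty∩ G⊆∁B) , F─B⊆G
      upper : ∀ G → Missing x G × Empty (G ∩ B) → # (λ F → kills? F G) ≤ 2 ^ (k + k)
      upper G ((∣G∣ , _) , _) = begin
        # (λ F → kills? F G)       ≤⟨ count-mono (λ F → kills? F G) (_⊆? (G ∪ B)) (subsets n) (λ { F (_ , _ , F─B⊆G) → to F─B⊆G }) ⟩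
        # (_⊆? (G ∪ B))            ≡⟨ #subsets (G ∪ B) ⟩
        2 ^ ∣ G ∪ B ∣              ≤⟨ ^-monoʳ-≤ 2 (≤-trans (∣p∪q∣≤∣p∣+∣q∣ {n} G B) (≤-reflexive (cong₂ _+_ ∣G∣ (∣∣≡k B∈)))) ⟩
        2 ^ (k + k)                ∎
        where
        open ≤-Reasoning
        to : ∀ {F} → F ─ B ⊆ G → F ⊆ G ∪ B
        to F─B⊆G {v} v∈F = x∈p∪q⁺ (Sum.swap (Sum.map₂ (λ v∉B → F─B⊆G (x∈p∧x∉q⇒x∈p─q v∈F v∉B)) (toSum (v ∈? B))))

    star-size : # (between? ⁅ x ⁆ (∁ B) (2 + j)) ≡ m
    star-size = #between ⁅ x ⁆ (∁ B) (e + (2 + j)) (2 + j) (⁅x⁆⊆ (x∉p⇒x∈∁p x∉B)) (begin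
      ∣ ∁ B ∣                      ≡⟨ ∣∁∣ B (∣∣≡k B∈) ⟩
      e + (3 + j)                  ≡⟨ trans (+-suc e (2 + j)) (+-comm 1 _) ⟩
      e + (2 + j) + 1              ≡⟨ cong (e + (2 + j) +_) (sym (∣⁅x⁆∣≡1 x)) ⟩
      e + (2 + j) + ∣ ⁅ x ⁆ ∣      ∎)
      where open ≡-Reasoning

    ∣star∣ : ∀ (G : Subset n) → ∣ G ∣ ≡ k → ∣ G ∣ ≡ 2 + j + ∣ ⁅ x ⁆ ∣
    ∣star∣ G ∣G∣ = trans ∣G∣ (trans (+-comm 1 (2 + j)) (cong (2 + j +_) (sym (∣⁅x⁆∣≡1 x))))

    -- The members through `x` that avoid `B` and the missing sets of `away? B` together make up the
    -- star of `x` in the complement of `B`.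
    size-bound : size 𝓕 + # (away? B) ≤ # outside? + # (meets? B) + m
    size-bound = begin
      size 𝓕 + # (away? B)
        ≤⟨ +-monoˡ-≤ (# (away? B)) size≤ ⟩
      # outside? + # (meets? B) + # (avoids? B) + # (away? B)
        ≡⟨ +-assoc (# outside? + # (meets? B)) _ _ ⟩
      # outside? + # (meets? B) + (# (avoids? B) + # (away? B))
        ≤⟨ +-monoʳ-≤ (# outside? + # (meets? B)) (count-disjoint (avoids? B) (away? B) (between? ⁅ x ⁆ (∁ B) (2 + j)) (subsets n)
             (λ { G (G∈ , x∈G , em) → ⁅x⁆⊆ x∈G , Empty∩⇒⊆∁ {G} {B} em , ∣star∣ G (∣∣≡k G∈) })
             (λ { G ((∣G∣ , x∈G , _) , em) → ⁅x⁆⊆ x∈G , Empty∩⇒⊆∁ {G} {B} em , ∣star∣ G ∣G∣ })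
             (λ { G (G∈ , _) ((_ , _ , G∉) , _) → G∉ G∈ })) ⟩
      # outside? + # (meets? B) + # (between? ⁅ x ⁆ (∁ B) (2 + j))
        ≡⟨ cong (# outside? + # (meets? B) +_) star-size ⟩
      # outside? + # (meets? B) + m ∎
      where
      open ≤-Reasoning
      contains? : Decidable (λ F → F ∈ᶠ 𝓕 × x ∈ F)
      contains? F = (F ∈ᶠ? 𝓕) ×-dec (x ∈? F)
      contains≤ : # contains? ≤ # (meets? B) + # (avoids? B)
      contains≤ = count-split contains? (meets? B) (avoids? B) (subsets n) λ { F (F∈ , x∈F) →
        Sum.map (λ ne → F∈ , x∈F , ne) (λ em → F∈ , x∈F , em) (toSum (nonempty? (F ∩ B))) }
      size≤ : size 𝓕 ≤ # outside? + # (meets? B) + # (avoids? B)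
      size≤ = begin
        size 𝓕                                              ≡⟨ size≡# 𝓕 {_∈ᶠ? 𝓕} ⟩
        # (_∈ᶠ? 𝓕)                                          ≤⟨ count-split (_∈ᶠ? 𝓕) outside? contains? (subsets n)
                                                                 (λ F F∈ → Sum.map (F∈ ,_) (F∈ ,_) (Sum.swap (toSum (x ∈? F)))) ⟩
        # outside? + # contains?                            ≤⟨ +-monoʳ-≤ (# outside?) contains≤ ⟩
        # outside? + (# (meets? B) + # (avoids? B))         ≡⟨ sym (+-assoc (# outside?) _ _) ⟩
        # outside? + # (meets? B) + # (avoids? B)           ∎

    missing-at? : ∀ w → Decidable (λ G → Missing x G × w ∈ G)
    missing-at? w G = missing? x G ×-dec (w ∈? G)

    through? : ∀ (Q : Subset n) w → Decidable (Between (⁅ x ⁆ ⊕ w) Q (1 + j))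
    through? Q w = between? (⁅ x ⁆ ⊕ w) Q (1 + j)

    through-spec : ∀ {Q w G} → w ≢ x → Between (⁅ x ⁆ ⊕ w) Q (1 + j) G → ∣ G ∣ ≡ k × x ∈ G × w ∈ G
    through-spec {w = w} w≢x (xw⊆G , _ , ∣G∣) =
      trans ∣G∣ (trans (cong (1 + j +_) (∣⁅x⁆⊕w∣ w≢x)) (+-comm (1 + j) 2)) ,
      xw⊆G (p⊆p⊕x (x∈⁅x⁆ x)) , xw⊆G (x∈p⊕x {p = ⁅ x ⁆})

    #through : ∀ {w} → w ≢ x → # (through? ⊤ w) ≡ binom (n ∸ 2) (1 + j)
    #through {w} w≢x = #between (⁅ x ⁆ ⊕ w) ⊤ (n ∸ 2) (1 + j) ⊆⊤ (begin
      ∣ ⊤ {n} ∣                    ≡⟨ ∣⊤∣≡n n ⟩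
      n                            ≡⟨ sym (m∸n+n≡m (≤-trans (s≤s (s≤s z≤n)) (≤-reflexive (sym n≡)))) ⟩
      n ∸ 2 + 2                    ≡⟨ cong (n ∸ 2 +_) (sym (∣⁅x⁆⊕w∣ w≢x)) ⟩
      n ∸ 2 + ∣ ⁅ x ⁆ ⊕ w ∣        ∎)
      where open ≡-Reasoning

    w≢x : ∀ {w} → w ∈ B → w ≢ x
    w≢x w∈B refl = x∉B w∈B

    -- A k-set through `x` and `w` is missing unless it is a member, and then it meets `B` at `w`.
    #missing-at : ∀ {w} → w ∈ B → binom (n ∸ 2) (1 + j) ≤ # (meets? B) + # (missing-at? w)
    #missing-at {w} w∈B = ≤-trans (≤-reflexive (sym (#through (w≢x w∈B))))
      (count-split (through? ⊤ w) (meets? B) (missing-at? w) (subsets n) λ G betw →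
        let ∣G∣ , x∈G , w∈G = through-spec (w≢x w∈B) betw in
        Sum.map (λ G∈ → G∈ , x∈G , w , x∈p∩q⁺ (w∈G , w∈B)) (λ G∉ → (∣G∣ , x∈G , G∉) , w∈G) (toSum (G ∈ᶠ? 𝓕)))

  -- Fix `w` in `B′` outside `B`. Each of the `b` k-sets through `x` and `w` that avoid `B` is
  -- either a member meeting `B′` at `w` or missing.
  two-outside : ∀ {B B′} → Outside B → Outside B′ → B ≢ B′ → b ≤ # (meets? B′) + # (away? B)
  two-outside {B} {B′} (B∈ , x∉B) (B′∈ , x∉B′) B≢B′ = bound
    where
    open Member B∈ x∉B using (through?; through-spec)
    new : ∃[ w ] (w ∈ B′ × w ∉ B)
    new = decidable-stable (Fin.any? (λ w → (w ∈? B′) ×-dec ¬? (w ∈? B))) λ none → B≢B′ (sym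
      (⊆∧∣∣≥⇒≡ (λ {v} v∈B′ → decidable-stable (v ∈? B) (λ v∉B → none (v , v∈B′ , v∉B)))
        (≤-reflexive (trans (∣∣≡k B∈) (sym (∣∣≡k B′∈))))))
    w : Fin n
    w = proj₁ new
    w∈B′ : w ∈ B′
    w∈B′ = proj₁ (proj₂ new)
    w∉B : w ∉ B
    w∉B = proj₂ (proj₂ new)
    w≢x : w ≢ x
    w≢x w≡x = x∉B′ (subst (_∈ B′) w≡x w∈B′)
    count-through : # (through? (∁ B) w) ≡ b
    count-through = #between (⁅ x ⁆ ⊕ w) (∁ B) (e + (1 + j)) (1 + j)
      (p⊕x⊆q (⁅x⁆⊆ (x∉p⇒x∈∁p x∉B)) (x∉p⇒x∈∁p w∉B)) (begin
        ∣ ∁ B ∣                                ≡⟨ ∣∁∣ B (∣∣≡k B∈) ⟩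
        e + (3 + j)                            ≡⟨ shift e j ⟩
        e + (1 + j) + 2                        ≡⟨ cong (e + (1 + j) +_) (sym (∣⁅x⁆⊕w∣ w≢x)) ⟩
        e + (1 + j) + ∣ ⁅ x ⁆ ⊕ w ∣            ∎)
      where
      open ≡-Reasoning
      shift : ∀ e j → e + (3 + j) ≡ e + (1 + j) + 2
      shift = solve-∀
    bound : b ≤ # (meets? B′) + # (away? B)
    bound = ≤-trans (≤-reflexive (sym count-through))
      (count-split (through? (∁ B) w) (meets? B′) (away? B) (subsets n) λ G betw@(_ , G⊆∁B , _) →
        let ∣G∣ , x∈G , w∈G = through-spec w≢x betw in
        Sum.map (λ G∈ → G∈ , x∈G , w , x∈p∩q⁺ (w∈G , w∈B′)) (λ G∉ → (∣G∣ , x∈G , G∉) , ⊆∁⇒Empty∩ G⊆∁B) (toSum (G ∈ᶠ? 𝓕)))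

  U : Subset n
  U = ⋃ (filter (λ F → ¬? (x ∈? F)) (Family.members 𝓕))

  outside⊆U : ∀ {F} → Outside F → F ⊆ U
  outside⊆U (F∈ , x∉F) v∈F = x∈⋃⁺ _ (∈-filter⁺ (λ F → ¬? (x ∈? F)) F∈ x∉F) v∈F

  #outside≤2^∣U∣ : # outside? ≤ 2 ^ ∣ U ∣
  #outside≤2^∣U∣ = ≤-trans (count-mono outside? (_⊆? U) (subsets n) (λ F out → outside⊆U out)) (≤-reflexive (#subsets U))

  module _ (a c : ℕ) .{{_ : NonZero c}} (few-missing : # (missing? x) ≤ c * a) (a≤2b : a ≤ 2 * b)
    (b≤ : b ≤ binom (n ∸ 2) (1 + j)) (c≤e : 2 ^ (k + k) * (c * 2) * 2 ≤ e) where

    -- By `e*#meets≤#away`, since `e` is at least twice `2 ^ (k + k)`.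
    twice-meets≤away : ∀ {B} → Outside B → 2 * # (meets? B) ≤ # (away? B)
    twice-meets≤away {B} (B∈ , x∉B) = cancel (2 ^ (k + k)) (m^n≢0 2 (k + k)) c≤e (Member.e*#meets≤#away B∈ x∉B)
      where
      cancel : ∀ q → NonZero q → q * (c * 2) * 2 ≤ e → e * # (meets? B) ≤ q * # (away? B) → 2 * # (meets? B) ≤ # (away? B)
      cancel q q≢0 q≤e le = *-cancelˡ-≤ q {{q≢0}} (begin
        q * (2 * # (meets? B))       ≡⟨ sym (*-assoc q 2 _) ⟩
        q * 2 * # (meets? B)         ≤⟨ *-monoˡ-≤ (# (meets? B)) (≤-trans (*-monoˡ-≤ 2 (m≤m*n q (c * 2) {{m*n≢0 c 2}})) q≤e) ⟩
        e * # (meets? B)             ≤⟨ le ⟩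
        q * # (away? B)              ∎)
        where open ≤-Reasoning

    -- The same comparison, continued by the bound `c * a ≤ c * (2 * b)` on all missing sets; the
    -- factor `c * 2` in the assumption on `e` absorbs this loss.
    twice-meets≤b : ∀ {B} → Outside B → 2 * # (meets? B) ≤ b
    twice-meets≤b {B} (B∈ , x∉B) = cancel (2 ^ (k + k)) (m^n≢0 2 (k + k)) c≤e (Member.e*#meets≤#away B∈ x∉B)
      where
      cancel : ∀ q → NonZero q → q * (c * 2) * 2 ≤ e → e * # (meets? B) ≤ q * # (away? B) → 2 * # (meets? B) ≤ b
      cancel q q≢0 q≤e le = *-cancelˡ-≤ (q * (c * 2)) {{m*n≢0 q (c * 2) {{q≢0}} {{m*n≢0 c 2}}}} (begin
        q * (c * 2) * (2 * # (meets? B))       ≡⟨ sym (*-assoc (q * (c * 2)) 2 _) ⟩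
        q * (c * 2) * 2 * # (meets? B)         ≤⟨ *-monoˡ-≤ (# (meets? B)) q≤e ⟩
        e * # (meets? B)                       ≤⟨ le ⟩
        q * # (away? B)                        ≤⟨ *-monoʳ-≤ q (≤-trans (#away≤#missing B) few-missing) ⟩
        q * (c * a)                            ≤⟨ *-monoʳ-≤ q (*-monoʳ-≤ c a≤2b) ⟩
        q * (c * (2 * b))                      ≡⟨ reassoc q c b ⟩
        q * (c * 2) * b                        ∎)
        where
        open ≤-Reasoning
        reassoc : ∀ q c b → q * (c * (2 * b)) ≡ q * (c * 2) * b
        reassoc = solve-∀

    1≤b : 1 ≤ b
    1≤b = ≤-trans (s≤s z≤n) (binom-lower e (1 + j) (s≤s z≤n))

    -- By `#missing-at` and `twice-meets≤b`, each vertex of `U` lies in at least `b / 2` missing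
    -- sets. Each missing set has `k` vertices, and there are at most `c * (2 * b)` of them.
    ∣U∣≤ : ∣ U ∣ ≤ 2 * (k * (c * 2))
    ∣U∣≤ = *-cancelˡ-≤ b {{>-nonZero 1≤b}} (begin
      b * ∣ U ∣                                    ≡⟨ cong (b *_) (sym (∣∣≡count U)) ⟩
      b * count (allFin n) (_∈? U)                 ≤⟨ double-count (allFin n) (subsets n) (_∈? U) R? (missing? x) {b} {k} {2}
                                                        lower upper (λ _ _ → proj₁) ⟩
      2 * (k * # (missing? x))                     ≤⟨ *-monoʳ-≤ 2 (*-monoʳ-≤ k (≤-trans few-missing (*-monoʳ-≤ c a≤2b))) ⟩
      2 * (k * (c * (2 * b)))                      ≡⟨ reassoc k c b ⟩
      b * (2 * (k * (c * 2)))                      ∎)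
      where
      open ≤-Reasoning
      reassoc : ∀ k c b → 2 * (k * (c * (2 * b))) ≡ b * (2 * (k * (c * 2)))
      reassoc = solve-∀
      R? : ∀ w → Decidable (λ G → Missing x G × w ∈ G)
      R? w G = missing? x G ×-dec (w ∈? G)
      upper : ∀ G → Missing x G → count (allFin n) (λ w → R? w G) ≤ k
      upper G (∣G∣ , _) = ≤-trans (count-mono (λ w → R? w G) (_∈? G) (allFin n) (λ _ → proj₂)) (≤-reflexive (trans (∣∣≡count G) ∣G∣))
      halve : ∀ {b m r} → 2 * m ≤ b → b ≤ m + r → b ≤ 2 * r
      halve {b} {m} {r} 2m≤b b≤m+r = +-cancelʳ-≤ b b (2 * r) (begin
        b + b              ≤⟨ +-mono-≤ b≤m+r b≤m+r ⟩
        m + r + (m + r)    ≡⟨ double m r ⟩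
        2 * r + 2 * m      ≤⟨ +-monoʳ-≤ (2 * r) 2m≤b ⟩
        2 * r + b          ∎)
        where
        double : ∀ m r → m + r + (m + r) ≡ 2 * r + 2 * m
        double = solve-∀
      lower : ∀ w → w ∈ U → b ≤ 2 * # (R? w)
      lower w w∈U =
        let B , B∈filter , w∈B = x∈⋃⁻ (filter (λ F → ¬? (x ∈? F)) (Family.members 𝓕)) w∈U
            B∈ , x∉B = ∈-filter⁻ (λ F → ¬? (x ∈? F)) B∈filter
        in halve {b} {# (meets? B)} {# (R? w)} (twice-meets≤b (B∈ , x∉B)) (≤-trans b≤ (Member.#missing-at B∈ x∉B w∈B))

    module _ (large : suc m ≤ size 𝓕) (L≤e : 4 * 2 ^ (2 * (k * (c * 2))) ≤ e) where

      -- A family larger than the star of `x` in the complement of `B` must make up for every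
      -- missing set of that star by members outside the star.
      #away<#outside+#meets : ∀ {B} → Outside B → suc (# (away? B)) ≤ # outside? + # (meets? B)
      #away<#outside+#meets {B} (B∈ , x∉B) = +-cancelʳ-≤ m _ _ (begin
        suc (# (away? B)) + m                ≡⟨ cong suc (+-comm (# (away? B)) m) ⟩
        suc m + # (away? B)                  ≤⟨ +-monoˡ-≤ (# (away? B)) large ⟩
        size 𝓕 + # (away? B)                 ≤⟨ Member.size-bound B∈ x∉B ⟩
        # outside? + # (meets? B) + m        ∎)
        where open ≤-Reasoning

      outside-unique : ∀ {B B′} → Outside B → Outside B′ → B ≡ B′
      outside-unique {B} {B′} outB outB′ = decidable-stable (B ≟ˢ B′) λ B≢B′ →
        absurd (# (away? B)) (# (meets? B)) (# (meets? B′)) (# outside?)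
          (twice-meets≤b outB′) (twice-meets≤away outB) (two-outside outB outB′ B≢B′) (#away<#outside+#meets outB)
          (≤-trans #outside≤2^∣U∣ (^-monoʳ-≤ 2 ∣U∣≤)) L≤e
        where
        -- From `h₁` and `h₃`, b ≤ 2 aw; from `h₂` and `h₄`, aw < 2 o. Hence b < 4 o ≤ 4 L ≤ e,
        -- although b > e by `binom-lower`.
        absurd : ∀ aw mB mB′ o {L} → 2 * mB′ ≤ b → 2 * mB ≤ aw → b ≤ mB′ + aw → suc aw ≤ o + mB → o ≤ L → 4 * L ≤ e → Absurd
        absurd aw mB mB′ o {L} h₁ h₂ h₃ h₄ h₅ h₆ = <-irrefl refl
          (+-cancelʳ-≤ (4 * o + b + 2 * mB′ + (2 * aw) + 2 * (2 * mB)) (suc e) e (begin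
          suc e + (4 * o + b + 2 * mB′ + 2 * aw + 2 * (2 * mB))
            ≤⟨ +-monoˡ-≤ (4 * o + b + 2 * mB′ + 2 * aw + 2 * (2 * mB)) (binom-lower e (1 + j) (s≤s z≤n)) ⟩
          b + (4 * o + b + 2 * mB′ + 2 * aw + 2 * (2 * mB))
            ≡⟨ i₁ b o mB′ aw mB ⟩
          b + b + 2 * mB′ + 2 * (2 * mB) + (4 * o + 2 * aw)
            ≤⟨ +-monoˡ-≤ (4 * o + 2 * aw) (+-mono-≤ (+-mono-≤ (+-mono-≤ h₃ h₃) h₁) (*-monoʳ-≤ 2 h₂)) ⟩
          mB′ + aw + (mB′ + aw) + b + 2 * aw + (4 * o + 2 * aw)
            ≤⟨ m≤m+n _ 4 ⟩
          mB′ + aw + (mB′ + aw) + b + 2 * aw + (4 * o + 2 * aw) + 4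
            ≡⟨ i₂ b o mB′ aw ⟩
          4 * suc aw + (4 * o + b + 2 * mB′ + 2 * aw)
            ≤⟨ +-monoˡ-≤ (4 * o + b + 2 * mB′ + 2 * aw) (*-monoʳ-≤ 4 h₄) ⟩
          4 * (o + mB) + (4 * o + b + 2 * mB′ + 2 * aw)
            ≡⟨ i₃ b o mB′ aw mB ⟩
          4 * o + (4 * o + b + 2 * mB′ + 2 * aw + 2 * (2 * mB))
            ≤⟨ +-monoˡ-≤ (4 * o + b + 2 * mB′ + 2 * aw + 2 * (2 * mB)) (≤-trans (*-monoʳ-≤ 4 h₅) h₆) ⟩
          e + (4 * o + b + 2 * mB′ + 2 * aw + 2 * (2 * mB)) ∎))
          where
          open ≤-Reasoning
          i₁ : ∀ b o n aw r → b + (4 * o + b + 2 * n + 2 * aw + 2 * (2 * r)) ≡ b + b + 2 * n + 2 * (2 * r) + (4 * o + 2 * aw)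
          i₁ = solve-∀
          i₂ : ∀ b o n aw → n + aw + (n + aw) + b + 2 * aw + (4 * o + 2 * aw) + 4 ≡ 4 * suc aw + (4 * o + b + 2 * n + 2 * aw)
          i₂ = solve-∀
          i₃ : ∀ b o n aw r → 4 * (o + r) + (4 * o + b + 2 * n + 2 * aw) ≡ 4 * o + (4 * o + b + 2 * n + 2 * aw + 2 * (2 * r))
          i₃ = solve-∀

      -- Once `B` is the only member missing `x`, no member through `x` meets `B`, and no set of the
      -- star in the complement of `B` is missing.
      extremal : ∀ {B} → Outside B →
        ∀ F → F ∈ᶠ 𝓕 ⇔ (F ≡ B ⊎ (∣ F ∣ ≡ k × F ⊆ ∁ B × x ∈ F))
      extremal {B} outB@(B∈ , x∉B) F = mk⇔ to from
        where
        -- With `o ≤ 1` the second bound gives `aw ≤ r`, against `2 * r ≤ aw`; so both vanish.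
        collapse : ∀ {aw r o} → 2 * r ≤ aw → suc aw ≤ o + r → o ≤ 1 → aw ≡ 0 × r ≡ 0
        collapse {aw} {r} {o} h₁ h₂ h₃ = n≤0⇒n≡0 (≤-trans aw≤r (≤-reflexive r≡0)) , r≡0
          where
          aw≤r : aw ≤ r
          aw≤r = ≤-pred (≤-trans h₂ (+-monoˡ-≤ r h₃))
          r≡0 : r ≡ 0
          r≡0 = n≤0⇒n≡0 (+-cancelˡ-≤ r r 0 (≤-trans (≤-reflexive (cong (r +_) (sym (+-identityʳ r))))
            (≤-trans h₁ (≤-trans aw≤r (≤-reflexive (sym (+-identityʳ r)))))))
        zeros : # (away? B) ≡ 0 × # (meets? B) ≡ 0
        zeros = collapse (twice-meets≤away outB) (#away<#outside+#meets outB)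
          (#-unique outside? (λ out out′ → outside-unique out out′))
        to : F ∈ᶠ 𝓕 → F ≡ B ⊎ (∣ F ∣ ≡ k × F ⊆ ∁ B × x ∈ F)
        to F∈ = Sum.map (λ x∉F → outside-unique (F∈ , x∉F) outB)
          (λ x∈F → ∣∣≡k F∈ , Empty∩⇒⊆∁ (λ ne → <⇒≱ (#-one (meets? B) F (F∈ , x∈F , ne)) (≤-reflexive (proj₂ zeros))) , x∈F)
          (Sum.swap (toSum (x ∈? F)))
        from : F ≡ B ⊎ (∣ F ∣ ≡ k × F ⊆ ∁ B × x ∈ F) → F ∈ᶠ 𝓕
        from (inj₁ F≡B) = subst (_∈ᶠ 𝓕) (sym F≡B) B∈
        from (inj₂ (∣F∣ , F⊆∁B , x∈F)) = decidable-stable (F ∈ᶠ? 𝓕) λ F∉ →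
          <⇒≱ (#-one (away? B) F ((∣F∣ , x∈F , F∉) , ⊆∁⇒Empty∩ F⊆∁B)) (≤-reflexive (proj₁ zeros))

-- Estimates for binomial coefficients

binom-step : ∀ n s → binom n s ≤ binom (suc n) s
binom-step n zero    = ≤-refl
binom-step n (suc s) = m≤n+m _ (binom n s)

binom-mono : ∀ t d s → binom d s ≤ binom (t + d) s
binom-mono zero    d s = ≤-refl
binom-mono (suc t) d s = ≤-trans (binom-mono t d s) (binom-step (t + d) s)

binom-monoˡ : ∀ {d n} s → d ≤ n → binom d s ≤ binom n s
binom-monoˡ {d} {n} s d≤n = ≤-trans (binom-mono (n ∸ d) d s) (≤-reflexive (cong (λ t → binom t s) (m∸n+n≡m d≤n)))

-- The identity (s+1) C(n, s+1) = (n-s) C(n, s) without subtraction.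
binom-absorb : ∀ n s → suc s * binom n (suc s) + s * binom n s ≡ n * binom n s
binom-absorb zero    zero    = refl
binom-absorb zero    (suc s) = cong₂ _+_ (*-zeroʳ s) (*-zeroʳ s)
binom-absorb (suc n) zero    = trans (expand (binom n 1)) (cong suc (trans (sym (+-identityʳ _)) (binom-absorb n 0)))
  where
  expand : ∀ b → 1 * (1 + b) + 0 * 1 ≡ suc (1 * b)
  expand = solve-∀
binom-absorb (suc n) (suc s) = begin
  (2 + s) * (b₁ + b₂) + suc s * (b₀ + b₁)                    ≡⟨ left s b₀ b₁ b₂ ⟩
  ((2 + s) * b₂ + suc s * b₁) + (suc s * b₁ + s * b₀) + (b₁ + b₀)
    ≡⟨ cong₂ (λ u v → u + v + (b₁ + b₀)) (binom-absorb n (suc s)) (binom-absorb n s) ⟩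
  n * b₁ + n * b₀ + (b₁ + b₀)                                ≡⟨ right n b₀ b₁ ⟩
  suc n * (b₀ + b₁)                                          ∎
  where
  open ≡-Reasoning
  b₀ b₁ b₂ : ℕ
  b₀ = binom n s
  b₁ = binom n (1 + s)
  b₂ = binom n (2 + s)
  left : ∀ s a b c → (2 + s) * (b + c) + suc s * (a + b) ≡ ((2 + s) * c + suc s * b) + (suc s * b + s * a) + (b + a)
  left = solve-∀
  right : ∀ n a b → n * b + n * a + (b + a) ≡ suc n * (a + b)
  right = solve-∀

binom-ratio : ∀ s r → suc s * binom (s + r) (suc s) ≡ r * binom (s + r) s
binom-ratio s r = +-cancelʳ-≡ (s * binom (s + r) s) _ _
  (trans (binom-absorb (s + r) s) (trans (*-distribʳ-+ (binom (s + r) s) s r) (+-comm (s * binom (s + r) s) _)))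

-- Each of the `t` steps from `d` to `t + d` adds one summand of Pascal's rule, and the summands
-- increase.
binom-shift : ∀ t d s → binom (t + d) (suc s) ≤ binom d (suc s) + t * binom (t + d) s
binom-shift zero    d s = m≤m+n _ _
binom-shift (suc t) d s = begin
  binom (t + d) s + binom (t + d) (suc s)                                  ≤⟨ +-monoʳ-≤ (binom (t + d) s) (binom-shift t d s) ⟩
  binom (t + d) s + (binom d (suc s) + t * binom (t + d) s)                ≡⟨ swap (binom (t + d) s) (binom d (suc s)) t ⟩
  binom d (suc s) + suc t * binom (t + d) s                                ≤⟨ +-monoʳ-≤ (binom d (suc s))
                                                                                  (*-monoʳ-≤ (suc t) (binom-step (t + d) s)) ⟩
  binom d (suc s) + suc t * binom (suc t + d) s                            ∎
  where
  open ≤-Reasoning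
  swap : ∀ a b t → a + (b + t * a) ≡ b + suc t * a
  swap = solve-∀

-- Passing from `n` to `d` loses at most `t * Y`. The ratio of `X` to `Y` is `r / suc s ≥ 2 * t`, so
-- the loss is at most half of `X`.
binom-half : ∀ {n} t d s r → n ≡ t + d → n ≡ s + r → 2 * t * suc s ≤ r →
  binom n (suc s) ≤ 2 * binom d (suc s)
binom-half {n} t d s r n≡t+d n≡s+r le = +-cancelʳ-≤ X X (2 * binom d (suc s)) (begin
  X + X                                  ≤⟨ +-mono-≤ X≤ X≤ ⟩
  D + t * Y + (D + t * Y)                ≡⟨ collect D t Y ⟩
  2 * D + 2 * t * Y                      ≤⟨ +-monoʳ-≤ (2 * D) 2tY≤X ⟩
  2 * D + X                              ∎)
  where
  open ≤-Reasoning
  X Y D : ℕ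
  X = binom n (suc s)
  Y = binom n s
  D = binom d (suc s)
  collect : ∀ D t Y → D + t * Y + (D + t * Y) ≡ 2 * D + 2 * t * Y
  collect = solve-∀
  reassoc : ∀ s t Y → s * (2 * t * Y) ≡ 2 * t * s * Y
  reassoc = solve-∀
  X≤ : X ≤ D + t * Y
  X≤ = subst (λ n → binom n (suc s) ≤ D + t * binom n s) (sym n≡t+d) (binom-shift t d s)
  2tY≤X : 2 * t * Y ≤ X
  2tY≤X = *-cancelˡ-≤ (suc s) (begin
    suc s * (2 * t * Y)      ≡⟨ reassoc (suc s) t Y ⟩
    2 * t * suc s * Y        ≤⟨ *-monoˡ-≤ Y le ⟩
    r * Y                    ≡⟨ subst (λ n → r * binom n s ≡ suc s * binom n (suc s)) (sym n≡s+r) (sym (binom-ratio s r)) ⟩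
    suc s * X                ∎)

-- The theorem for large ground sets

multiplier : ℕ → ℕ
multiplier j = (3 + j) * deficiency j

-- The four summands ensure in turn that a labelled set passes through the vertex found by
-- averaging, that C(n, k-2) ≤ 2 C(n-k-2, k-2), that few members through `x` meet a member missing
-- `x`, and that `e` is at least four times the bound on the number of members missing `x`.
threshold : ℕ → ℕ
threshold j =
  (2 + j) * deficiency j * 2 +
  (2 * (5 + j) * (1 + j) +
  (2 ^ ((3 + j) + (3 + j)) * (multiplier j * 2) * 2 +
  4 * 2 ^ (2 * ((3 + j) * (multiplier j * 2)))))

IsExtremal : ∀ {n k} → Family n k → Set
IsExtremal {n} {k} 𝓕 = ∃[ B ] ∃[ x ] (∣ B ∣ ≡ k × x ∉ B ×
  (∀ (F : Subset n) → F ∈ᶠ 𝓕 ⇔ (F ≡ B ⊎ (∣ F ∣ ≡ k × F ⊆ ∁ B × x ∈ F))))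

module LargeGround (j e : ℕ) (e-large : threshold j ≤ e) where

  k n m : ℕ
  k = 3 + j
  n = k + (e + k)
  m = binom (e + (2 + j)) (2 + j)

  module _ (𝓕 : Family n k) (free : ClusterFree 3 𝓕) {A B : Subset n} (A∈ : A ∈ᶠ 𝓕) (B∈ : B ∈ᶠ 𝓕) (disj : Disjoint A B) where

    -- Assuming only `suc m ≤ size 𝓕` serves both claims: the upper bound follows from the size of
    -- extremal families, and equality forces the structure.
    large⇒extremal : suc m ≤ size 𝓕 → IsExtremal 𝓕
    large⇒extremal large = result
      where
      -- `Stability` takes the predecessor of the number of vertices.
      open Stability (2 + j + (e + k)) j 𝓕 free using (a; facets; frequent-label)
      open Structure n j 𝓕 free using (Missing; missing?; ∣∣≡k)
      module E = Endgame n j e refl 𝓕 free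

      b : ℕ
      b = binom (e + (1 + j)) (1 + j)

      E₁ E₂ E₃ E₄ : ℕ
      E₁ = (2 + j) * deficiency j * 2
      E₂ = 2 * (5 + j) * (1 + j)
      E₃ = 2 ^ (k + k) * (multiplier j * 2) * 2
      E₄ = 4 * 2 ^ (2 * (k * (multiplier j * 2)))

      E₁≤e : E₁ ≤ e
      E₁≤e = ≤-trans (m≤m+n E₁ (E₂ + (E₃ + E₄))) e-large
      E₂≤e : E₂ ≤ e
      E₂≤e = ≤-trans (≤-trans (m≤m+n E₂ (E₃ + E₄)) (m≤n+m (E₂ + (E₃ + E₄)) E₁)) e-large
      E₃₄≤e : E₃ + E₄ ≤ e
      E₃₄≤e = ≤-trans (≤-trans (m≤n+m (E₃ + E₄) E₂) (m≤n+m (E₂ + (E₃ + E₄)) E₁)) e-large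

      e≤n : e ≤ 2 + j + (e + k)
      e≤n = ≤-trans (m≤m+n e k) (m≤n+m (e + k) (2 + j))

      facets≤ : facets ≤ size 𝓕 + (1 + k) * a
      -- `n` exceeds n - k - 1 by `1 + k`, the number of steps of `binom-shift`.
      facets≤ = ≤-trans (subst (λ N → binom N (2 + j) ≤ m + (1 + k) * binom N (1 + j)) (sym (split j e))
          (binom-shift (1 + k) (e + (2 + j)) (1 + j)))
        (+-monoˡ-≤ ((1 + k) * a) (≤-trans (n≤1+n m) large))
        where
        split : ∀ j e → 3 + j + (e + (3 + j)) ≡ 1 + (3 + j) + (e + (2 + j))
        split = solve-∀

      a≤2b : a ≤ 2 * b
      -- Here `5 + j` is k + 2, the difference between `n` and `e + (1 + j)`.
      a≤2b = binom-half (5 + j) (e + (1 + j)) j (3 + (e + k)) (by-t j e) (by-s j e)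
        (≤-trans E₂≤e (≤-trans (m≤m+n e k) (m≤n+m (e + k) 3)))
        where
        by-t : ∀ j e → 3 + j + (e + (3 + j)) ≡ 5 + j + (e + (1 + j))
        by-t = solve-∀
        by-s : ∀ j e → 3 + j + (e + (3 + j)) ≡ j + (3 + (e + (3 + j)))
        by-s = solve-∀

      e+1+j≤ : e + (1 + j) ≤ n ∸ 2
      e+1+j≤ = ≤-trans (+-monoʳ-≤ e (m≤n+m (1 + j) 2)) (m≤n+m (e + k) (1 + j))

      b≤ : b ≤ binom (n ∸ 2) (1 + j)
      b≤ = binom-monoˡ (1 + j) e+1+j≤

      b≤′ : b ≤ binom (2 + j + (e + k)) (1 + j)
      b≤′ = ≤-trans b≤ (binom-step (n ∸ 2) (1 + j))

      1≤b : 1 ≤ b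
      1≤b = ≤-trans (s≤s z≤n) (binom-lower e (1 + j) (s≤s z≤n))

      center : ∃[ x ] (# (missing? x) ≤ k * deficiency j * a)
      center = frequent-label facets≤ (≤-trans E₁≤e e≤n) (≤-trans a≤2b (*-monoʳ-≤ 2 b≤′)) (≤-trans 1≤b b≤′)

      x : Fin n
      x = proj₁ center

      -- Of two disjoint members at least one misses `x`; this is where the matching number enters.
      off-center : ∃[ F ] (F ∈ᶠ 𝓕 × x ∉ F)
      off-center = Sum.[ (λ x∈A → B , B∈ , λ x∈B → disj (x , x∈p∩q⁺ (x∈A , x∈B))) , (λ x∉A → A , A∈ , x∉A) ]′ (toSum (x ∈? A))

      instance
        multiplier≢0 : NonZero (multiplier j)
        multiplier≢0 = m*n≢0 k (deficiency j)

      result : IsExtremal 𝓕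
      result = proj₁ off-center , x , ∣∣≡k (proj₁ (proj₂ off-center)) , proj₂ (proj₂ off-center) ,
        E.extremal x a (multiplier j) (proj₂ center) a≤2b b≤
          (≤-trans (m≤m+n E₃ E₄) E₃₄≤e) large (≤-trans (m≤n+m E₄ E₃) E₃₄≤e) (proj₂ off-center)

  -- The disjoint union of a k-set and a star

  ∣∁B∣ : ∀ B → ∣ B ∣ ≡ k → ∣ ∁ {n} B ∣ ≡ e + k
  ∣∁B∣ B ∣B∣ = trans (∣∁p∣≡n∸∣p∣ B) (trans (cong (n ∸_) ∣B∣) (m+n∸m≡n k (e + k)))

  module Star (B : Subset n) (∣B∣ : ∣ B ∣ ≡ k) (x : Fin n) (x∉B : x ∉ B) where

    InStar : Subset n → Set
    InStar F = ∣ F ∣ ≡ k × F ⊆ ∁ B × x ∈ F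

    inStar? : Decidable InStar
    inStar? F = (∣ F ∣ ≟ k) ×-dec (F ⊆? ∁ B) ×-dec (x ∈? F)

    #inStar : # inStar? ≡ m
    #inStar = trans
      (#-cong inStar? (between? ⁅ x ⁆ (∁ B) (2 + j))
        (λ F (∣F∣ , F⊆ , x∈F) → (λ v∈ → subst (_∈ F) (sym (x∈⁅y⁆⇒x≡y x v∈)) x∈F) , F⊆ , trans ∣F∣ size≡)
        (λ F (x⊆F , F⊆ , ∣F∣) → trans ∣F∣ (sym size≡) , F⊆ , x⊆F (x∈⁅x⁆ x)))
      (#between ⁅ x ⁆ (∁ B) (e + (2 + j)) (2 + j)
        (λ v∈ → subst (_∈ ∁ B) (sym (x∈⁅y⁆⇒x≡y x v∈)) (x∉p⇒x∈∁p x∉B))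
        (trans (∣∁B∣ B ∣B∣) (trans (shift e j) (cong (e + (2 + j) +_) (sym (∣⁅x⁆∣≡1 x))))))
      where
      size≡ : k ≡ 2 + j + ∣ ⁅ x ⁆ ∣
      size≡ = trans (+-comm 1 (2 + j)) (cong (2 + j +_) (sym (∣⁅x⁆∣≡1 x)))
      shift : ∀ e j → e + (3 + j) ≡ e + (2 + j) + 1
      shift = solve-∀

  extremal-size≤ : ∀ (𝓕 : Family n k) → IsExtremal 𝓕 → size 𝓕 ≤ suc m
  extremal-size≤ 𝓕 (B , x , ∣B∣ , x∉B , iff) = begin
    size 𝓕                              ≡⟨ size≡# 𝓕 {_∈ᶠ? 𝓕} ⟩
    # (_∈ᶠ? 𝓕)                            ≤⟨ count-split (_∈ᶠ? 𝓕) (_≟ˢ B) inStar? (subsets n) (λ F → Equivalence.to (iff F)) ⟩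
    # (_≟ˢ B) + # inStar?               ≤⟨ +-mono-≤ (#-unique (_≟ˢ B) (λ p q → trans p (sym q))) (≤-reflexive #inStar) ⟩
    suc m                               ∎
    where
    open ≤-Reasoning
    open Star B ∣B∣ x x∉B

  matched : ∀ {𝓕 : Family n k} → MatchingNumber≥ 𝓕 2 → ∃[ A ] ∃[ B ] (A ∈ᶠ 𝓕 × B ∈ᶠ 𝓕 × Disjoint A B)
  matched (_ , ((A ∷ B ∷ _ , record { inFamily = A∈ ∷ B∈ ∷ _ ; disjoint = (d ∷ _) ∷ _ } , _) , _) , _) = A , B , A∈ , B∈ , d
  matched (_ , (([] , _ , refl) , _) , ())
  matched (_ , ((_ ∷ [] , _ , refl) , _) , s≤s ())

  size≤ : ∀ (𝓕 : Family n k) → ClusterFree 3 𝓕 → MatchingNumber≥ 𝓕 2 → size 𝓕 ≤ suc m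
  size≤ 𝓕 free ν≥2 with matched {𝓕} ν≥2 | suc m ≤? size 𝓕
  ... | A , B , A∈ , B∈ , d | yes large = extremal-size≤ 𝓕 (large⇒extremal 𝓕 free A∈ B∈ d large)
  ... | _                   | no small  = ≤-trans (≤-pred (≰⇒> small)) (n≤1+n m)

  module Construction (B : Subset n) (∣B∣ : ∣ B ∣ ≡ k) (x : Fin n) (x∉B : x ∉ B) where

    open Star B ∣B∣ x x∉B

    B∉star : ¬ InStar B
    B∉star (_ , _ , x∈B) = x∉B x∈B

    family : Family n k
    family = record
      { members = B ∷ filter inStar? (subsets n)
      ; unique  = All.tabulate (λ {F} F∈ B≡F → B∉star (subst InStar (sym B≡F) (proj₂ (∈-filter⁻ inStar? {xs = subsets n} F∈)))) ∷
                  Unique.filter⁺ inStar? (subsets-unique n)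
      ; uniform = ∣B∣ ∷ All.tabulate (λ F∈ → proj₁ (proj₂ (∈-filter⁻ inStar? {xs = subsets n} F∈)))
      }

    family⁻ : ∀ {F} → F ∈ᶠ family → F ≡ B ⊎ InStar F
    family⁻ (here F≡B) = inj₁ F≡B
    family⁻ (there F∈) = inj₂ (proj₂ (∈-filter⁻ inStar? {xs = subsets n} F∈))

    family-size : size family ≡ suc m
    family-size = cong suc (trans (length-filter≡count inStar? (subsets n)) #inStar)

    -- Two different star sets have a union of more than `k` vertices, and it is disjoint from `B`.
    wide : ∀ {F G U} → InStar F → InStar G → F ≢ G → B ⊆ U → F ⊆ U → G ⊆ U → ¬ (∣ U ∣ ≤ 2 * k)
    wide {F} {G} {U} (∣F∣ , F⊆ , _) (∣G∣ , G⊆ , _) F≢G B⊆U F⊆U G⊆U U≤ = <⇒≱ (begin-strict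
      2 * k                  ≡⟨ cong₂ _+_ (sym ∣B∣) (trans (+-identityʳ k) (sym ∣F∣)) ⟩
      ∣ B ∣ + ∣ F ∣          <⟨ +-monoʳ-< ∣ B ∣ F<F∪G ⟩
      ∣ B ∣ + ∣ F ∪ G ∣      ≡⟨ sym (∣p∪q∣≡∣p∣+∣q∣ B (F ∪ G) (λ v∈B v∈ → x∈∁p⇒x∉p (F∪G⊆ F⊆ G⊆ v∈) v∈B)) ⟩
      ∣ B ∪ (F ∪ G) ∣        ≤⟨ p⊆q⇒∣p∣≤∣q∣ (λ v∈ → Sum.[ B⊆U , F∪G⊆ F⊆U G⊆U ]′ (x∈p∪q⁻ B (F ∪ G) v∈)) ⟩
      ∣ U ∣                  ∎) U≤
      where
      open ≤-Reasoning
      F∪G⊆ : ∀ {V} → F ⊆ V → G ⊆ V → F ∪ G ⊆ V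
      F∪G⊆ F⊆V G⊆V v∈ = Sum.[ F⊆V , G⊆V ]′ (x∈p∪q⁻ F G v∈)
      F<F∪G : ∣ F ∣ < ∣ F ∪ G ∣
      F<F∪G = ≰⇒> λ le →
        let F≡F∪G = ⊆∧∣∣≥⇒≡ (p⊆p∪q {p = F} G) le
            G⊆F   = λ {v} (v∈G : v ∈ G) → subst (v ∈_) (sym F≡F∪G) (q⊆p∪q F G v∈G)
        in F≢G (sym (⊆∧∣∣≥⇒≡ G⊆F (≤-reflexive (trans ∣F∣ (sym ∣G∣)))))

    -- Three different members either include `B` and two star sets, whose union is too large, or
    -- are all star sets and share `x`.
    family-free : ClusterFree 3 family
    family-free (F ∷ G ∷ H ∷ [] , record
        { different    = (F≢G ∷ F≢H ∷ []) ∷ (G≢H ∷ []) ∷ [] ∷ []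
        ; small-union  = small
        ; empty-common = empty
        } , F∈ ∷ G∈ ∷ H∈ ∷ []) =
      cases (family⁻ F∈) (family⁻ G∈) (family⁻ H∈)
      where
      in₁ : F ⊆ ⋃ (F ∷ G ∷ H ∷ [])
      in₁ = x∈⋃⁺ (F ∷ G ∷ H ∷ []) (here refl)
      in₂ : G ⊆ ⋃ (F ∷ G ∷ H ∷ [])
      in₂ = x∈⋃⁺ (F ∷ G ∷ H ∷ []) (there (here refl))
      in₃ : H ⊆ ⋃ (F ∷ G ∷ H ∷ [])
      in₃ = x∈⋃⁺ (F ∷ G ∷ H ∷ []) (there (there (here refl)))
      cases : F ≡ B ⊎ InStar F → G ≡ B ⊎ InStar G → H ≡ B ⊎ InStar H → Absurd
      cases (inj₁ F≡B) (inj₁ G≡B) _          = F≢G (trans F≡B (sym G≡B))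
      cases (inj₁ F≡B) _          (inj₁ H≡B) = F≢H (trans F≡B (sym H≡B))
      cases _          (inj₁ G≡B) (inj₁ H≡B) = G≢H (trans G≡B (sym H≡B))
      cases (inj₁ F≡B) (inj₂ G∈)  (inj₂ H∈)  = wide G∈ H∈ G≢H (subst (_⊆ _) F≡B in₁) in₂ in₃ small
      cases (inj₂ F∈)  (inj₁ G≡B) (inj₂ H∈)  = wide F∈ H∈ F≢H (subst (_⊆ _) G≡B in₂) in₁ in₃ small
      cases (inj₂ F∈)  (inj₂ G∈)  (inj₁ H≡B) = wide F∈ G∈ F≢G (subst (_⊆ _) H≡B in₃) in₁ in₂ small
      cases (inj₂ (_ , _ , x∈F)) (inj₂ (_ , _ , x∈G)) (inj₂ (_ , _ , x∈H)) =
        empty (x , x∈p∩q⁺ (x∈F , x∈p∩q⁺ (x∈G , x∈p∩q⁺ (x∈H , ∈⊤))))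

    -- The matching number is exactly 2: `B` is disjoint from every star set, and among three
    -- different members two are star sets, which meet in `x`.
    family-matching : MatchingNumber≥ family 2
    family-matching = 2 , ((B ∷ G ∷ [] , record
        { different = (B≢G ∷ []) ∷ [] ∷ []
        ; inFamily  = here refl ∷ there (∈-filter⁺ inStar? (∈-subsets G) G∈) ∷ []
        ; disjoint  = ((λ { (v , v∈) → let v∈B , v∈G = x∈p∩q⁻ B G v∈ in x∈∁p⇒x∉p (proj₁ (proj₂ G∈) v∈G) v∈B }) ∷ []) ∷ [] ∷ []
        } , refl) , at-most) , ≤-refl
      where
      star-member : ∃ InStar
      star-member = count-witness inStar? (subsets n)
        (≤-trans (≤-trans (s≤s z≤n) (binom-lower e (2 + j) (s≤s z≤n))) (≤-reflexive (sym #inStar)))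
      G : Subset n
      G = proj₁ star-member
      G∈ : InStar G
      G∈ = proj₂ star-member
      B≢G : B ≢ G
      B≢G B≡G = B∉star (subst InStar (sym B≡G) G∈)
      meet : ∀ {F G} → InStar F → InStar G → ¬ Disjoint F G
      meet (_ , _ , x∈F) (_ , _ , x∈G) d = d (x , x∈p∩q⁺ (x∈F , x∈G))
      at-most : ∀ s → ∃[ M ] (IsMatching family M × length M ≡ s) → s ≤ 2
      at-most s ([] , _ , refl) = z≤n
      at-most s (_ ∷ [] , _ , refl) = s≤s z≤n
      at-most s (_ ∷ _ ∷ [] , _ , refl) = ≤-refl
      at-most s (P ∷ Q ∷ R ∷ _ , record { different = (P≢Q ∷ P≢R ∷ _) ∷ (Q≢R ∷ _) ∷ _
                                        ; inFamily  = P∈ ∷ Q∈ ∷ R∈ ∷ _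
                                        ; disjoint  = (PQ ∷ PR ∷ _) ∷ (QR ∷ _) ∷ _ } , _) =
        ⊥-elim (cases (family⁻ P∈) (family⁻ Q∈) (family⁻ R∈))
        where
        cases : P ≡ B ⊎ InStar P → Q ≡ B ⊎ InStar Q → R ≡ B ⊎ InStar R → Absurd
        cases (inj₁ P≡B) (inj₁ Q≡B) _          = P≢Q (trans P≡B (sym Q≡B))
        cases (inj₁ P≡B) (inj₂ _)   (inj₁ R≡B) = P≢R (trans P≡B (sym R≡B))
        cases (inj₁ _)   (inj₂ Q∈)  (inj₂ R∈)  = meet Q∈ R∈ QR
        cases (inj₂ _)   (inj₁ Q≡B) (inj₁ R≡B) = Q≢R (trans Q≡B (sym R≡B))
        cases (inj₂ P∈)  (inj₁ _)   (inj₂ R∈)  = meet P∈ R∈ PR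
        cases (inj₂ P∈)  (inj₂ Q∈)  _          = meet P∈ Q∈ PQ

  -- A set `B` exists because C(n, k) is positive, and `x` because the complement of `B` has `e + k`
  -- vertices.
  attained : ∃[ 𝓕 ] (ClusterFree {n} {k} 3 𝓕 × MatchingNumber≥ 𝓕 2 × size 𝓕 ≡ suc m)
  attained =
    let B , ∣B∣ = count-witness (λ P → ∣ P ∣ ≟ k) (subsets n) (≤-trans
          (≤-trans (≤-trans (s≤s z≤n) (binom-lower (e + k) k (s≤s z≤n))) (≤-reflexive (cong (λ N → binom N k) (+-comm (e + k) k))))
          (≤-reflexive (sym (#size n k))))
        x , x∈∁B = ∣p∣≥1⇒nonempty {p = ∁ B} (≤-trans (≤-trans (s≤s z≤n) (m≤n+m k e)) (≤-reflexive (sym (∣∁B∣ B ∣B∣))))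
        open Construction B ∣B∣ x (x∈∁p⇒x∉p x∈∁B)
    in family , family-free , family-matching , family-size

-- From ground sets of size `k + (e + k)` to all large `n`

Conclusion : ℕ → ℕ → Set
Conclusion k n =
  (f[ n , k , 3 , 1 ]≡ ((n ∸ k ∸ 1) C (k ∸ 1) + 1)) ×
  (∀ (𝓕 : Family n k) → ClusterFree 3 𝓕 → MatchingNumber≥ 𝓕 2 →
    size 𝓕 ≡ (n ∸ k ∸ 1) C (k ∸ 1) + 1 → IsExtremal 𝓕)

conclusion : ∀ j e → threshold j ≤ e → Conclusion (3 + j) (3 + j + (e + (3 + j)))
conclusion j e e-large =
  subst (λ v → f[ n , k , 3 , 1 ]≡ v) (sym value≡)
    (attained , λ { _ (𝓕 , free , ν≥2 , refl) → size≤ 𝓕 free ν≥2 }) ,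
  λ 𝓕 free ν≥2 size≡ →
    let A , B , A∈ , B∈ , d = matched {𝓕} ν≥2
    in large⇒extremal 𝓕 free A∈ B∈ d (≤-reflexive (sym (trans size≡ value≡)))
  where
  open LargeGround j e e-large
  value≡ : (n ∸ k ∸ 1) C (k ∸ 1) + 1 ≡ suc m
  value≡ = trans (+-comm _ 1) (cong suc (trans
    (cong (λ N → (N ∸ 1) C (2 + j)) (trans (m+n∸m≡n k (e + k)) (+-suc e (2 + j))))
    (sym (binom≡C (e + (2 + j)) (2 + j)))))

theorem1p9 : ∀ (k : ℕ) → 3 ≤ k →
    ∃[ n₀ ] (∀ (n : ℕ) → n₀ ≤ n →
    (f[ n , k , 3 , 1 ]≡ ((n ∸ k ∸ 1) C (k ∸ 1) + 1))
    ×
    (∀ (𝓕 : Family n k) →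
    ClusterFree 3 𝓕 →
    MatchingNumber≥ 𝓕 2 →
    size 𝓕 ≡ (n ∸ k ∸ 1) C (k ∸ 1) + 1 →
    ∃[ B ] ∃[ x ]
    (∣ B ∣ ≡ k × x ∉ B ×
    (∀ (F : Subset n) →
    F ∈ᶠ 𝓕 ⇔ (F ≡ B ⊎ (∣ F ∣ ≡ k × F ⊆ ∁ B × x ∈ F))))))
theorem1p9 (suc (suc (suc j))) (s≤s (s≤s (s≤s _))) = n₀ , λ n n₀≤n →
  -- Every `n ≥ n₀` is `k + (e + k)` for `e = E + (n ∸ n₀)`, which is at least the threshold.
  subst (Conclusion k) (decompose n n₀≤n) (conclusion j (E + (n ∸ n₀)) (m≤m+n E (n ∸ n₀)))
  where
  k E n₀ : ℕ
  k = 3 + j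
  E = threshold j
  n₀ = k + (E + k)
  decompose : ∀ n → n₀ ≤ n → k + (E + (n ∸ n₀) + k) ≡ n
  decompose n n₀≤n = trans (rearrange k E (n ∸ n₀)) (m+[n∸m]≡n n₀≤n)
    where
    rearrange : ∀ k E o → k + (E + o + k) ≡ k + (E + k) + o
    rearrange = solve-∀
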